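{- Let $n\ge 5$ be an odd integer, let $D=D(H_n)$ be the distance matrix of the helm graph $H_n$, and let $\mathbf{w}=\frac14\left(5-n,\,-\mathbf{e}',\,2\mathbf{e}'\right)'\in\mathbb{R}^{2n-1}$, where $\mathbf{e}\in\mathbb{R}^{n-1}$ is the all-ones vector. Let $$L=\begin{bmatrix}\frac{n-1}{2} & -\frac12\mathbf{e}' & \mathbf{0}'\\ -\frac12\mathbf{e} & A & B\\ \mathbf{0} & B & I_{n-1}\end{bmatrix},$$ where $A=\mathrm{Circ}(\mathbf{x}')$ and $B=\mathrm{Circ}(\mathbf{y}')$ are the circulant matrices of order $n-1$ defined in the context. Then the Moore-Penrose inverse of $D$ is $$D^{\dagger}=-\frac12 L+\frac{4}{3(n-1)}\mathbf{w}\mathbf{w}'.$$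
   Context: A prime denotes transpose; $\mathbf{e}$ and $\mathbf{0}$ are the all-ones and zero column vectors (here in $\mathbb{R}^{n-1}$), $J_{n-1}$ is the all-ones matrix and $I_{n-1}$ the identity matrix of order $n-1$. For $\mathbf{a}=(a_1,\dots,a_N)'\in\mathbb{R}^N$, $\mathrm{Circ}(\mathbf{a}')$ is the $N\times N$ circulant matrix with first row $(a_1,a_2,\dots,a_N)$, each subsequent row being the previous row cyclically shifted one place to the right. Helm graph: for $n\ge4$, the wheel $W_n$ consists of a cycle on $v_1,\dots,v_{n-1}$ together with a vertex $v_0$ adjacent to all $v_i$; the helm graph $H_n$ (on $2n-1$ vertices) is obtained from $W_n$ by attaching to each $v_i$, $1\le i\le n-1$, a pendant vertex $u_i$. The distance matrix $D(H_n)$ has as entries the shortest-path distances, with vertices ordered $v_0,v_1,\dots,v_{n-1},u_1,\dots,u_{n-1}$. Explicitly, $$D(H_n)=\begin{bmatrix}0&\mathbf{e}'&2\mathbf{e}'\\ \mathbf{e}&2J_{n-1}-S&3J_{n-1}-S\\ 2\mathbf{e}&3J_{n-1}-S&4J_{n-1}-S-2I_{n-1}\end{bmatrix},\quad S=\mathrm{Circ}(\mathbf{s}'),\ \mathbf{s}=(2,1,0,\dots,0,1)'\in\mathbb{R}^{n-1}.$$ Vectors $\mathbf{x},\mathbf{y}$ (for odd $n\ge5$): put $m=\frac{n-1}{2}$ and, for $1\le k\le m$, $\alpha_k=(-1)^{k+1}\left[2m^2-6(m-k)^2+7\right]$. Then $$\mathbf{x}=\frac{1}{6(n-1)}(n^2+4n-12,\alpha_1,\alpha_2,\dots,\alpha_{m-1},\alpha_m,\alpha_{m-1},\dots,\alpha_2,\alpha_1)'\in\mathbb{R}^{n-1},$$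 $$\mathbf{y}=\frac{1}{n-1}(2-n,-1,1,-1,1,\dots,-1,1,-1)'\in\mathbb{R}^{n-1}.$$ The Moore-Penrose inverse $M^\dagger$ of a real matrix $M$ is the unique $X$ with $MXM=M$, $XMX=X$, $(MX)'=MX$, $(XM)'=XM$. -}

module Defs where

open import Data.Bool.Base using (if_then_else_)
open import Data.Empty using (⊥)
open import Data.Fin.Base using (Fin; zero; suc; toℕ; splitAt)
open import Data.Fin.Properties using (any?; _≟_)
open import Data.Integer.Base as ℤ using (ℤ; +_; 1ℤ; -1ℤ)
open import Data.Nat.Base as ℕ using (ℕ; zero; suc; NonZero; _∸_; _⊓_; _≤_; s≤s)
import Data.Nat.Properties as ℕ
open import Data.Nat.DivMod using (_%_; _mod_)
open import Data.Product.Base using (∃; _×_)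
open import Data.Rational.Base as ℚ using (ℚ; 0ℚ; 1ℚ; ½; -½)
open import Data.Rational.Properties using (+-0-commutativeMonoid)
open import Data.Sum.Base using (_⊎_; [_,_]′)
open import Data.Unit.Base using (⊤)
open import Data.Vec.Functional using (Vector)
open import Level using (0ℓ)
open import Relation.Binary.Core using (Rel)
open import Relation.Binary.Definitions using (Decidable)
open import Relation.Binary.PropositionalEquality using (_≡_)
open import Relation.Nullary.Decidable using (yes; no; does; _×-dec_; _⊎-dec_)
open import Algebra.Properties.CommutativeMonoid.Sum +-0-commutativeMonoid using (sum)

fromℤ : ℤ → ℚ
fromℤ z = z ℚ./ 1

------------------------------------------------------------------------
-- Matrices.  All matrices below have rational entries, and the four Penrose
-- equations between rational matrices mean the same over ℚ as over the reals.

Matrix : ℕ → ℕ → Set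
Matrix m n = Fin m → Fin n → ℚ

infix  4 _≋_
infixl 6 _⊕_
infixl 7 _⊗_ _•_
infix  8 _ᵀ

-- Entrywise equality, since function extensionality is not available.
_≋_ : ∀ {m n} → Rel (Matrix m n) 0ℓ
M ≋ N = ∀ i j → M i j ≡ N i j

_⊕_ : ∀ {m n} → Matrix m n → Matrix m n → Matrix m n
(M ⊕ N) i j = M i j ℚ.+ N i j

_•_ : ∀ {m n} → ℚ → Matrix m n → Matrix m n
(c • M) i j = c ℚ.* M i j

_⊗_ : ∀ {m n p} → Matrix m n → Matrix n p → Matrix m p
(M ⊗ N) i j = sum (λ k → M i k ℚ.* N k j)

_ᵀ : ∀ {m n} → Matrix m n → Matrix n m
(M ᵀ) i j = M j i

column : ∀ {n} → Vector ℚ n → Matrix n 1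
column v i _ = v i

identity : ∀ {n} → Matrix n n
identity i j = if does (i ≟ j) then 1ℚ else 0ℚ

-- The entry in position (i , j) is a at (j - i) modulo N, so row 0 is a and
-- each row is the previous one shifted cyclically one place to the right.
Circ : ∀ {N} .{{_ : NonZero N}} → Vector ℚ N → Matrix N N
Circ {N} a i j = a ((toℕ j ℕ.+ (N ∸ toℕ i)) mod N)

record Penrose {m n} (M : Matrix m n) (X : Matrix n m) : Set where
  field
    MXM≋M    : M ⊗ X ⊗ M ≋ M
    XMX≋X    : X ⊗ M ⊗ X ≋ X
    [MX]ᵀ≋MX : (M ⊗ X) ᵀ ≋ M ⊗ X
    [XM]ᵀ≋XM : (X ⊗ M) ᵀ ≋ X ⊗ M

record IsMoorePenroseInverse {m n} (M : Matrix m n) (X : Matrix n m) : Set where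
  field
    penrose : Penrose M X
    unique  : ∀ Y → Penrose M Y → Y ≋ X

------------------------------------------------------------------------
-- Distances in a graph on Fin N with adjacency relation _~_

module Distance {N : ℕ} {_~_ : Rel (Fin N) 0ℓ} (_~?_ : Decidable _~_) where

  Walk : ℕ → Rel (Fin N) 0ℓ
  Walk zero    i j = i ≡ j
  Walk (suc k) i j = ∃ λ l → (i ~ l) × Walk k l j

  walk? : ∀ k → Decidable (Walk k)
  walk? zero    i j = i ≟ j
  walk? (suc k) i j = any? (λ l → (i ~? l) ×-dec walk? k l j)

  -- The least l in k, ..., k + fuel - 1 such that there is a walk of length l
  -- from i to j, and k + fuel if there is none.
  search : (i j : Fin N) (fuel k : ℕ) → ℕ
  search i j zero       k = k
  search i j (suc fuel) k =
    if does (walk? k i j) then k else search i j fuel (suc k)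

  -- A shortest walk repeats no vertex, so lengths below N suffice; the value
  -- is N when i and j are not connected.
  dist : Fin N → Fin N → ℕ
  dist i j = search i j N 0

  distanceMatrix : Matrix N N
  distanceMatrix i j = fromℤ (+ dist i j)

------------------------------------------------------------------------
-- Vertices of the helm graph with r rim vertices, in the order
-- hub, rim vertices, pendant vertices.

data Vertex (r : ℕ) : Set where
  hub     : Vertex r
  rim     : Fin r → Vertex r
  pendant : Fin r → Vertex r

order : ℕ → ℕ
order r = 1 ℕ.+ (r ℕ.+ r)

vertex : ∀ {r} → Fin (order r) → Vertex r
vertex     zero    = hub
vertex {r} (suc i) = [ rim , pendant ]′ (splitAt r i)

module Rim (r : ℕ) .{{_ : NonZero r}} where

  Next : Rel (Fin r) 0ℓ
  Next i j = toℕ j ≡ suc (toℕ i) % r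

  Adjacent : Rel (Vertex r) 0ℓ
  Adjacent hub         (rim _)     = ⊤
  Adjacent (rim _)     hub         = ⊤
  Adjacent (rim i)     (rim j)     = Next i j ⊎ Next j i
  Adjacent (rim i)     (pendant j) = i ≡ j
  Adjacent (pendant i) (rim j)     = i ≡ j
  Adjacent hub         hub         = ⊥
  Adjacent hub         (pendant _) = ⊥
  Adjacent (pendant _) hub         = ⊥
  Adjacent (pendant _) (pendant _) = ⊥

  adjacent? : Decidable Adjacent
  adjacent? hub         (rim _)     = yes _
  adjacent? (rim _)     hub         = yes _
  adjacent? (rim i)     (rim j)     =
    (toℕ j ℕ.≟ suc (toℕ i) % r) ⊎-dec (toℕ i ℕ.≟ suc (toℕ j) % r)
  adjacent? (rim i)     (pendant j) = i ≟ j
  adjacent? (pendant i) (rim j)     = i ≟ j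
  adjacent? hub         hub         = no λ ()
  adjacent? hub         (pendant _) = no λ ()
  adjacent? (pendant _) hub         = no λ ()
  adjacent? (pendant _) (pendant _) = no λ ()

------------------------------------------------------------------------
-- The matrices attached to H_n; the rim has n ∸ 1 vertices and the graph
-- has order (n ∸ 1) = 2n - 1 vertices.

module Helm (n : ℕ) (5≤n : 5 ≤ n) where

  private
    r : ℕ
    r = n ∸ 1

  instance
    r-nonZero : NonZero r
    r-nonZero = ℕ.>-nonZero (ℕ.≤-trans (s≤s ℕ.z≤n) (ℕ.∸-monoˡ-≤ 1 5≤n))

    3r-nonZero : NonZero (3 ℕ.* r)
    3r-nonZero = ℕ.m*n≢0 3 r

    6r-nonZero : NonZero (6 ℕ.* r)
    6r-nonZero = ℕ.m*n≢0 6 r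

  open Rim r

  _~_ : Rel (Fin (order r)) 0ℓ
  u ~ v = Adjacent (vertex u) (vertex v)

  _~?_ : Decidable _~_
  u ~? v = adjacent? (vertex u) (vertex v)

  D : Matrix (order r) (order r)
  D = Distance.distanceMatrix _~?_

  m : ℕ
  m = r ℕ./ 2

  α : ℕ → ℤ
  α k = -1ℤ ℤ.^ (k ℕ.+ 1) ℤ.*
        (+ 2 ℤ.* (+ m) ℤ.^ 2 ℤ.- + 6 ℤ.* (+ m ℤ.- + k) ℤ.^ 2 ℤ.+ + 7)

  -- With entries numbered from 0, entry k is α k for 1 ≤ k ≤ m, and the
  -- remaining entries run back through α (m - 1), ..., α 1: entry k is
  -- α (2m - k), where 2m = r for odd n.
  x-numerator : ℕ → ℤ
  x-numerator zero    = (+ n) ℤ.^ 2 ℤ.+ + 4 ℤ.* + n ℤ.- + 12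
  x-numerator (suc i) = α (suc i ⊓ (r ∸ suc i))

  x : Vector ℚ r
  x k = (1ℤ ℚ./ (6 ℕ.* r)) ℚ.* fromℤ (x-numerator (toℕ k))

  y-numerator : ℕ → ℤ
  y-numerator zero    = + 2 ℤ.- + n
  y-numerator (suc i) = -1ℤ ℤ.^ suc i

  y : Vector ℚ r
  y k = (1ℤ ℚ./ r) ℚ.* fromℤ (y-numerator (toℕ k))

  A : Matrix r r
  A = Circ x

  B : Matrix r r
  B = Circ y

  L-entry : Vertex r → Vertex r → ℚ
  L-entry hub         hub         = (+ n ℤ.- 1ℤ) ℚ./ 2
  L-entry hub         (rim _)     = -½
  L-entry hub         (pendant _) = 0ℚ
  L-entry (rim _)     hub         = -½
  L-entry (rim i)     (rim j)     = A i j
  L-entry (rim i)     (pendant j) = B i j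
  L-entry (pendant _) hub         = 0ℚ
  L-entry (pendant i) (rim j)     = B i j
  L-entry (pendant i) (pendant j) = identity i j

  L : Matrix (order r) (order r)
  L u v = L-entry (vertex u) (vertex v)

  w-numerator : Vertex r → ℤ
  w-numerator hub         = + 5 ℤ.- + n
  w-numerator (rim _)     = -1ℤ
  w-numerator (pendant _) = + 2

  w : Vector ℚ (order r)
  w u = (1ℤ ℚ./ 4) ℚ.* fromℤ (w-numerator (vertex u))

module Submission where

-- Let r = n - 1 = 2m, c = 1/r, let z be the vector that is (-1)ⁱ on the rim
-- and 0 elsewhere, and let X be the claimed inverse.  Then D and X are
-- symmetric and annihilate z, so it is enough to see that D X is the
-- projection P = I - c z z'.  This reduces to D w = (3r/4) e and
-- D L = 2 e w' - 2 P.  For the latter, with ε the restriction of z to the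
-- rim, B = c ε ε' - I and A = I - (c/6) K, where
-- K i j = (-1)ⁱ⁺ʲ β(|i - j|) and β(d) = 7 - 4m² + 12md - 6d².  Since β has
-- second difference -12 and β(2m - d) = β(d), the circulant S satisfies
-- S K = 12 ε ε' - 12 r I, while S ε = 0.

open import Defs
open import Algebra.Bundles using (CommutativeRing)
open import Data.Bool.Base using (if_then_else_)
open import Data.Fin.Base as Fin using (Fin; zero; suc; toℕ; splitAt; inject₁; _↑ˡ_; _↑ʳ_; join)
open import Data.Fin.Permutation as Perm using (Permutation; permutation)
open import Data.Fin.Properties as Fin using (_≟_)
open import Data.Integer.Base as ℤ using (ℤ; +_; 1ℤ; -1ℤ)
import Data.Integer.Properties as ℤ
open import Data.Nat.Base as ℕ using (ℕ; zero; suc; NonZero; _∸_; _≤_; _<_; _⊓_; z≤n; s≤s; ∣_-_∣)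
open import Data.Nat.Coprimality using (1-coprimeTo) renaming (sym to coprime-sym)
open import Data.Nat.DivMod
  using (_%_; _mod_; m<n⇒m%n≡m; n%n≡0; m%n<n; [m+n]%n≡m%n; m≡m%n+[m/n]*n; %-distribˡ-+)
import Data.Nat.Properties as ℕ
open import Data.Product.Base using (∃; _×_; _,_)
open import Data.Rational.Base using (ℚ; mkℚ; 0ℚ; 1ℚ; ½; -½; _+_; _*_; _-_; -_; _/_; toℚᵘ)
open import Data.Rational.Properties as ℚ using (+-*-commutativeRing)
open import Data.Rational.Solver using (module +-*-Solver)
import Data.Rational.Unnormalised.Base as ℚᵘ
import Data.Rational.Unnormalised.Properties as ℚᵘ
open import Data.Sum.Base using (_⊎_; inj₁; inj₂; [_,_]′; map₁)
open import Data.Unit.Base using (tt)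
open import Function.Base using (_∘_)
open import Level using (0ℓ)
open import Relation.Binary.Bundles using (Setoid)
open import Relation.Binary.Core using (Rel)
open import Relation.Binary.Definitions using (Decidable)
open import Relation.Binary.PropositionalEquality as ≡
  using (_≡_; _≢_; refl; cong; cong₂; trans; subst; module ≡-Reasoning)
import Relation.Binary.Reasoning.Setoid as SetoidReasoning
open import Relation.Nullary.Decidable using (yes; no; does; dec⇒maybe)
open import Relation.Nullary.Negation using (contradiction)
open import Algebra.Properties.Ring (CommutativeRing.ring +-*-commutativeRing) using (-‿involutive)
open import Algebra.Properties.Semiring.Sum (CommutativeRing.semiring +-*-commutativeRing)
open import Tactic.RingSolver using (solve-∀)
open import Tactic.RingSolver.Core.AlmostCommutativeRing using (AlmostCommutativeRing; fromCommutativeRing)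

-- The coefficient 4/(3r) is the reciprocal of the 3r/4 in D w: the term -L/2 turns D L into P - e
-- w', and the rank-one term restores exactly e w'. D L is accessible because each block of D
-- between rim and pendant vertices is a multiple of the all-ones matrix minus S, with a further -2I
-- in the pendant block. A row of D therefore sees a vector only through its hub entry, its two
-- block totals, S applied to the sum of its rim and pendant parts and, for a pendant row, one
-- entry. In a rim column of L that sum comes from A + B, where the identity terms cancel; in a
-- pendant column it comes from B + I = c ε ε', which S kills. The obstacle is that S is singular. S
-- multiplies totals by 4, so S K yields the column totals of K; but ε lies in the kernel of S, so S
-- K says nothing about ε' K, which z' X = 0 requires. That product is found by summing β around the
-- cycle with an explicit antiderivative. The identity term in S K comes from the corner of β(|d|)
-- at d = 0, where the second difference is 24m - 12 instead of -12.

ring : AlmostCommutativeRing 0ℓ 0ℓ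
ring = fromCommutativeRing +-*-commutativeRing (λ x → dec⇒maybe (0ℚ ℚ.≟ x))

-- The embedding of ℤ and ℕ in ℚ

fromℤ-mkℚ : ∀ z → fromℤ z ≡ mkℚ z 0 (coprime-sym (1-coprimeTo _))
fromℤ-mkℚ z = ℚ.fromℚᵘ-toℚᵘ (mkℚ z 0 (coprime-sym (1-coprimeTo _)))

-- The quotient `z / 1` is normalised through a gcd that is stuck on a variable; in constructor form
-- the sum computes, up to factors 1.
fromℤ-+ : ∀ y z → fromℤ (y ℤ.+ z) ≡ fromℤ y + fromℤ z
fromℤ-+ y z = ≡.sym (trans (cong₂ _+_ (fromℤ-mkℚ y) (fromℤ-mkℚ z))
  (cong fromℤ (cong₂ ℤ._+_ (ℤ.*-identityʳ y) (ℤ.*-identityʳ z))))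

fromℤ-* : ∀ y z → fromℤ (y ℤ.* z) ≡ fromℤ y * fromℤ z
fromℤ-* y z = ≡.sym (cong₂ _*_ (fromℤ-mkℚ y) (fromℤ-mkℚ z))

fromℤ-neg : ∀ z → fromℤ (ℤ.- z) ≡ - fromℤ z
fromℤ-neg (+ zero)    = refl
fromℤ-neg (+ (suc _)) = refl
fromℤ-neg ℤ.-[1+ n ]  = ≡.sym (-‿involutive (fromℤ (+ suc n)))

fromℤ-- : ∀ y z → fromℤ (y ℤ.- z) ≡ fromℤ y - fromℤ z
fromℤ-- y z = trans (fromℤ-+ y (ℤ.- z)) (cong (λ q → fromℤ y + q) (fromℤ-neg z))

fromℕ : ℕ → ℚ
fromℕ k = fromℤ (+ k)

fromℕ-suc : ∀ k → fromℕ (suc k) ≡ 1ℚ + fromℕ k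
fromℕ-suc k = fromℤ-+ 1ℤ (+ k)

fromℕ-+ : ∀ j k → fromℕ (j ℕ.+ k) ≡ fromℕ j + fromℕ k
fromℕ-+ j k = fromℤ-+ (+ j) (+ k)

fromℕ-* : ∀ j k → fromℕ (j ℕ.* k) ≡ fromℕ j * fromℕ k
fromℕ-* j k = trans (cong fromℤ (ℤ.pos-* j k)) (fromℤ-* (+ j) (+ k))

fromℤ-^2 : ∀ z → fromℤ (z ℤ.^ 2) ≡ fromℤ z * fromℤ z
fromℤ-^2 z = trans (cong (λ y → fromℤ (z ℤ.* y)) (ℤ.*-identityʳ z)) (fromℤ-* z z)

-- Unnormalised fractions avoid the gcd in `z / d`; there the claim is a cross-multiplication in ℤ.
/-*-cancel : ∀ z d .{{_ : NonZero d}} → z / d * fromℕ d ≡ fromℤ z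
/-*-cancel z d@(suc d-1) = ℚ.toℚᵘ-injective (begin
  toℚᵘ (z / d * fromℕ d)               ≈⟨ ℚ.toℚᵘ-homo-* (z / d) (fromℕ d) ⟩
  toℚᵘ (z / d) ℚᵘ.* toℚᵘ (fromℕ d)     ≈⟨ ℚᵘ.*-cong (ℚ.toℚᵘ-fromℚᵘ (ℚᵘ.mkℚᵘ z d-1))
      (ℚ.toℚᵘ-fromℚᵘ (ℚᵘ.mkℚᵘ (+ d) 0)) ⟩
  ℚᵘ.mkℚᵘ z d-1 ℚᵘ.* ℚᵘ.mkℚᵘ (+ d) 0   ≈⟨ ℚᵘ.*≡*
      (trans (ℤ.*-identityʳ _) (cong (λ e → z ℤ.* + e) (≡.sym (ℕ.*-identityʳ d)))) ⟩
  ℚᵘ.mkℚᵘ z 0                          ≈⟨ ℚ.toℚᵘ-fromℚᵘ (ℚᵘ.mkℚᵘ z 0) ⟨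
  toℚᵘ (fromℤ z)                       ∎)
  where open SetoidReasoning ℚᵘ.≃-setoid

-- Matrices and the Moore-Penrose inverse

≋-setoid : ℕ → ℕ → Setoid 0ℓ 0ℓ
≋-setoid m n = record
  { Carrier       = Matrix m n
  ; _≈_           = _≋_
  ; isEquivalence = record
    { refl  = λ _ _ → refl
    ; sym   = λ M≋N i j → ≡.sym (M≋N i j)
    ; trans = λ M≋N N≋O i j → trans (M≋N i j) (N≋O i j)
    }
  }

module _ {m n : ℕ} where
  open Setoid (≋-setoid m n) public using ()
    renaming (sym to ≋-sym; trans to ≋-trans)

≋-refl : ∀ {m n} {M : Matrix m n} → M ≋ M
≋-refl _ _ = refl

⊗-cong : ∀ {m n p} {M M′ : Matrix m n} {N N′ : Matrix n p} →
         M ≋ M′ → N ≋ N′ → M ⊗ N ≋ M′ ⊗ N′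
⊗-cong M≋M′ N≋N′ i j = sum-cong-≗ λ k → cong₂ _*_ (M≋M′ i k) (N≋N′ k j)

⊗-assoc : ∀ {m n p q} (M : Matrix m n) (N : Matrix n p) (O : Matrix p q) →
          M ⊗ N ⊗ O ≋ M ⊗ (N ⊗ O)
⊗-assoc M N O i j = begin
  sum (λ l → sum (λ k → M i k * N k l) * O l j)
    ≡⟨ sum-cong-≗ (λ l → *-distribʳ-sum (O l j) (λ k → M i k * N k l)) ⟩
  sum (λ l → sum (λ k → M i k * N k l * O l j))
    ≡⟨ ∑-comm (λ l k → M i k * N k l * O l j) ⟩
  sum (λ k → sum (λ l → M i k * N k l * O l j))
    ≡⟨ sum-cong-≗ (λ k → sum-cong-≗ λ l → ℚ.*-assoc (M i k) (N k l) (O l j)) ⟩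
  sum (λ k → sum (λ l → M i k * (N k l * O l j)))
    ≡⟨ sum-cong-≗ (λ k → *-distribˡ-sum (M i k) (λ l → N k l * O l j)) ⟨
  sum (λ k → M i k * sum (λ l → N k l * O l j)) ∎
  where open ≡-Reasoning

ᵀ-⊗ : ∀ {m n p} (M : Matrix m n) (N : Matrix n p) → (M ⊗ N) ᵀ ≋ N ᵀ ⊗ M ᵀ
ᵀ-⊗ M N i j = sum-cong-≗ λ k → ℚ.*-comm (M j k) (N k i)

ᵀ-cong : ∀ {m n} {M N : Matrix m n} → M ≋ N → M ᵀ ≋ N ᵀ
ᵀ-cong M≋N i j = M≋N j i

module _ {m n} {M : Matrix m n} {X Y : Matrix n m} (pX : Penrose M X) (pY : Penrose M Y) where
  private
    module X = Penrose pX
    module Y = Penrose pY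

  -- Both products are symmetric and fix the range of `M`. From MYM = M follows (MY)(MX) = MX; its
  -- transpose is (MX)(MY), which MXM = M reduces to MY.
  MX≋MY : M ⊗ X ≋ M ⊗ Y
  MX≋MY = begin
    M ⊗ X                    ≈⟨ ⊗-cong Y.MXM≋M ≋-refl ⟨
    M ⊗ Y ⊗ M ⊗ X            ≈⟨ ⊗-assoc (M ⊗ Y) M X ⟩
    M ⊗ Y ⊗ (M ⊗ X)          ≈⟨ ⊗-cong Y.[MX]ᵀ≋MX X.[MX]ᵀ≋MX ⟨
    (M ⊗ Y) ᵀ ⊗ (M ⊗ X) ᵀ    ≈⟨ ᵀ-⊗ (M ⊗ X) (M ⊗ Y) ⟨
    (M ⊗ X ⊗ (M ⊗ Y)) ᵀ      ≈⟨ ᵀ-cong (⊗-assoc (M ⊗ X) M Y) ⟨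
    (M ⊗ X ⊗ M ⊗ Y) ᵀ        ≈⟨ ᵀ-cong (⊗-cong X.MXM≋M ≋-refl) ⟩
    (M ⊗ Y) ᵀ                ≈⟨ Y.[MX]ᵀ≋MX ⟩
    M ⊗ Y                    ∎
    where open SetoidReasoning (≋-setoid m m)

  -- The mirror image of `MX≋MY`, with the products taken on the other side.
  XM≋YM : X ⊗ M ≋ Y ⊗ M
  XM≋YM = begin
    X ⊗ M                    ≈⟨ ⊗-cong (≋-refl {M = X}) Y.MXM≋M ⟨
    X ⊗ (M ⊗ Y ⊗ M)          ≈⟨ ⊗-cong (≋-refl {M = X}) (⊗-assoc M Y M) ⟩
    X ⊗ (M ⊗ (Y ⊗ M))        ≈⟨ ⊗-assoc X M (Y ⊗ M) ⟨
    X ⊗ M ⊗ (Y ⊗ M)          ≈⟨ ⊗-cong X.[XM]ᵀ≋XM Y.[XM]ᵀ≋XM ⟨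
    (X ⊗ M) ᵀ ⊗ (Y ⊗ M) ᵀ    ≈⟨ ᵀ-⊗ (Y ⊗ M) (X ⊗ M) ⟨
    (Y ⊗ M ⊗ (X ⊗ M)) ᵀ      ≈⟨ ᵀ-cong (⊗-assoc Y M (X ⊗ M)) ⟩
    (Y ⊗ (M ⊗ (X ⊗ M))) ᵀ    ≈⟨ ᵀ-cong (⊗-cong (≋-refl {M = Y}) (⊗-assoc M X M)) ⟨
    (Y ⊗ (M ⊗ X ⊗ M)) ᵀ      ≈⟨ ᵀ-cong (⊗-cong (≋-refl {M = Y}) X.MXM≋M) ⟩
    (Y ⊗ M) ᵀ                ≈⟨ Y.[XM]ᵀ≋XM ⟩
    Y ⊗ M                    ∎
    where open SetoidReasoning (≋-setoid n n)

  penrose-unique : Y ≋ X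
  penrose-unique = begin
    Y              ≈⟨ Y.XMX≋X ⟨
    Y ⊗ M ⊗ Y      ≈⟨ ⊗-assoc Y M Y ⟩
    Y ⊗ (M ⊗ Y)    ≈⟨ ⊗-cong (≋-refl {M = Y}) MX≋MY ⟨
    Y ⊗ (M ⊗ X)    ≈⟨ ⊗-assoc Y M X ⟨
    Y ⊗ M ⊗ X      ≈⟨ ⊗-cong XM≋YM ≋-refl ⟨
    X ⊗ M ⊗ X      ≈⟨ X.XMX≋X ⟩
    X              ∎
    where open SetoidReasoning (≋-setoid n m)

-- Transposing MX = P gives XM = P as well, so both symmetry conditions reduce to that of `P`, and
-- the other two say that `P` fixes `M` and `X`.
symmetric⇒moorePenrose : ∀ {n} {M X P : Matrix n n} →
  M ᵀ ≋ M → X ᵀ ≋ X → P ᵀ ≋ P →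
  M ⊗ X ≋ P → P ⊗ M ≋ M → P ⊗ X ≋ X → IsMoorePenroseInverse M X
symmetric⇒moorePenrose {n} {M} {X} {P} Mᵀ≋M Xᵀ≋X Pᵀ≋P MX≋P PM≋M PX≋X = record
  { penrose = penrose
  ; unique  = λ Y pY → penrose-unique penrose pY
  }
  where
  XM≋P : X ⊗ M ≋ P
  XM≋P = begin
    X ⊗ M        ≈⟨ ⊗-cong Xᵀ≋X Mᵀ≋M ⟨
    X ᵀ ⊗ M ᵀ    ≈⟨ ᵀ-⊗ M X ⟨
    (M ⊗ X) ᵀ    ≈⟨ ᵀ-cong MX≋P ⟩
    P ᵀ          ≈⟨ Pᵀ≋P ⟩
    P            ∎
    where open SetoidReasoning (≋-setoid n n)

  penrose : Penrose M X
  penrose = record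
    { MXM≋M    = ≋-trans (⊗-cong MX≋P ≋-refl) PM≋M
    ; XMX≋X    = ≋-trans (⊗-cong XM≋P ≋-refl) PX≋X
    ; [MX]ᵀ≋MX = ≋-trans (ᵀ-cong MX≋P) (≋-trans Pᵀ≋P (≋-sym MX≋P))
    ; [XM]ᵀ≋XM = ≋-trans (ᵀ-cong XM≋P) (≋-trans Pᵀ≋P (≋-sym XM≋P))
    }

-- Finite sums

open ≡-Reasoning

sum-identity : ∀ {n} (i : Fin n) (f : Fin n → ℚ) → sum (λ k → identity i k * f k) ≡ f i
sum-identity {suc n} zero f = begin
  1ℚ * f zero + sum (λ k → 0ℚ * f (suc k))
    ≡⟨ cong₂ _+_ (ℚ.*-identityˡ (f zero)) (sum-cong-≗ (λ k → ℚ.*-zeroˡ (f (suc k)))) ⟩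
  f zero + sum {n} (λ _ → 0ℚ)
    ≡⟨ cong (λ q → f zero + q) (sum-replicate-zero n) ⟩
  f zero + 0ℚ
    ≡⟨ ℚ.+-identityʳ (f zero) ⟩
  f zero ∎
sum-identity {suc n} (suc i) f =
  trans (cong₂ _+_ (ℚ.*-zeroˡ (f zero)) (sum-identity i (f ∘ suc))) (ℚ.+-identityˡ (f (suc i)))

identity-sym : ∀ {n} (i j : Fin n) → identity i j ≡ identity j i
identity-sym zero    zero    = refl
identity-sym zero    (suc j) = refl
identity-sym (suc i) zero    = refl
identity-sym (suc i) (suc j) = identity-sym i j

sum-linear : ∀ {n} a b (f g : Fin n → ℚ) → sum (λ i → a * f i + b * g i) ≡ a * sum f + b * sum g
sum-linear a b f g = trans (∑-distrib-+ (λ i → a * f i) (λ i → b * g i))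
  (≡.sym (cong₂ _+_ (*-distribˡ-sum a f) (*-distribˡ-sum b g)))

sum-identityᵀ : ∀ {n} (j : Fin n) (f : Fin n → ℚ) → sum (λ i → identity i j * f i) ≡ f j
sum-identityᵀ j f = trans (sum-cong-≗ (λ i → cong (_* f i) (identity-sym i j))) (sum-identity j f)

sum-identity-column : ∀ {n} (j : Fin n) → sum (λ i → identity i j) ≡ 1ℚ
sum-identity-column j = trans (sum-cong-≗ (λ i → ≡.sym (ℚ.*-identityʳ (identity i j))))
    (sum-identityᵀ j (λ _ → 1ℚ))

-- Taking `f` on the sum type lets the induction pass to `f ∘ map₁ suc`, which follows the recursion
-- of `splitAt`.
sum-splitAt : ∀ m {n} (f : Fin m ⊎ Fin n → ℚ) →
              sum (f ∘ splitAt m) ≡ sum (f ∘ inj₁) + sum (f ∘ inj₂)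
sum-splitAt zero    f = ≡.sym (ℚ.+-identityˡ _)
sum-splitAt (suc m) f =
  trans (cong (λ q → f (inj₁ zero) + q) (sum-splitAt m (f ∘ map₁ suc)))
        (≡.sym (ℚ.+-assoc (f (inj₁ zero)) _ _))

sum-telescope : ∀ n (T : ℕ → ℚ) → sum {n} (λ i → T (suc (toℕ i)) - T (toℕ i)) ≡ T n - T 0
sum-telescope zero    T = ≡.sym (ℚ.+-inverseʳ (T 0))
sum-telescope (suc n) T = trans (cong (λ q → T 1 - T 0 + q) (sum-telescope n (T ∘ suc)))
    (lemma (T 1) (T 0) (T (suc n)))
  where
  lemma : ∀ a b c → a - b + (c - a) ≡ c - b
  lemma = solve-∀ ring

sum-const : ∀ n q → sum {n} (λ _ → q) ≡ fromℕ n * q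
sum-const zero    q = ≡.sym (ℚ.*-zeroˡ q)
sum-const (suc n) q = begin
  q + sum {n} (λ _ → q)         ≡⟨ cong (λ s → q + s) (sum-const n q) ⟩
  q + fromℕ n * q               ≡⟨ lemma q (fromℕ n) ⟩
  (1ℚ + fromℕ n) * q            ≡⟨ cong (_* q) (fromℕ-suc n) ⟨
  fromℕ (suc n) * q             ∎
  where
  lemma : ∀ a b → a + b * a ≡ (1ℚ + b) * a
  lemma = solve-∀ ring

-- Indices and vertices of the helm graph

module _ {r : ℕ} where

  index : Vertex r → Fin (order r)
  index hub         = zero
  index (rim i)     = suc (i ↑ˡ r)
  index (pendant i) = suc (r ↑ʳ i)

  vertex-index : ∀ v → vertex (index v) ≡ v
  vertex-index hub         = refl
  vertex-index (rim i)     = cong [ rim , pendant ]′ (Fin.splitAt-↑ˡ r i r)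
  vertex-index (pendant i) = cong [ rim , pendant ]′ (Fin.splitAt-↑ʳ r r i)

  index-vertex : ∀ (u : Fin (order r)) → index (vertex u) ≡ u
  index-vertex zero    = refl
  index-vertex (suc i) = trans (lemma (splitAt r i)) (cong suc (Fin.join-splitAt r r i))
    where
    lemma : ∀ s → index ([ rim , pendant ]′ s) ≡ suc (join r r s)
    lemma (inj₁ _) = refl
    lemma (inj₂ _) = refl

  vertex-injective : ∀ {u v : Fin (order r)} → vertex u ≡ vertex v → u ≡ v
  vertex-injective {u} {v} eq = trans (≡.sym (index-vertex u)) (trans (cong index eq) (index-vertex v))

  sumᵛ : (Vertex r → ℚ) → ℚ
  sumᵛ f = f hub + (sum (f ∘ rim) + sum (f ∘ pendant))

  sum-vertex : ∀ f → sum (f ∘ vertex) ≡ sumᵛ f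
  sum-vertex f = cong (λ q → f hub + q) (sum-splitAt r (f ∘ [ rim , pendant ]′))

  identityᵛ : Vertex r → Vertex r → ℚ
  identityᵛ hub         hub         = 1ℚ
  identityᵛ (rim i)     (rim j)     = identity i j
  identityᵛ (pendant i) (pendant j) = identity i j
  identityᵛ _           _           = 0ℚ

identity-↑ˡ : ∀ {m} n (i j : Fin m) → identity (i ↑ˡ n) (j ↑ˡ n) ≡ identity i j
identity-↑ˡ n zero    zero    = refl
identity-↑ˡ n zero    (suc j) = refl
identity-↑ˡ n (suc i) zero    = refl
identity-↑ˡ n (suc i) (suc j) = identity-↑ˡ n i j

identity-↑ʳ : ∀ m {n} (i j : Fin n) → identity (m ↑ʳ i) (m ↑ʳ j) ≡ identity i j
identity-↑ʳ zero    i j = refl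
identity-↑ʳ (suc m) i j = identity-↑ʳ m i j

identity-↑ˡ-↑ʳ : ∀ {m n} (i : Fin m) (j : Fin n) → identity (i ↑ˡ n) (m ↑ʳ j) ≡ 0ℚ
identity-↑ˡ-↑ʳ zero    j = refl
identity-↑ˡ-↑ʳ (suc i) j = identity-↑ˡ-↑ʳ i j

-- On indices of the form `index u` the identity matrix computes block by block, whereas `vertex` of
-- a variable index is stuck; `identity-vertex` transports the result.
identity-index : ∀ r (u v : Vertex r) → identity (index u) (index v) ≡ identityᵛ u v
identity-index r hub         hub         = refl
identity-index r hub         (rim _)     = refl
identity-index r hub         (pendant _) = refl
identity-index r (rim _)     hub         = refl
identity-index r (rim i)     (rim j)     = identity-↑ˡ r i j
identity-index r (rim i)     (pendant j) = identity-↑ˡ-↑ʳ i j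
identity-index r (pendant _) hub         = refl
identity-index r (pendant i) (rim j)     =
  trans (identity-sym (r ↑ʳ i) (j ↑ˡ r)) (identity-↑ˡ-↑ʳ j i)
identity-index r (pendant i) (pendant j) = identity-↑ʳ r i j

identity-vertex : ∀ r (u v : Fin (order r)) → identity u v ≡ identityᵛ (vertex {r} u) (vertex v)
identity-vertex r u v = trans
  (≡.sym (cong₂ identity (index-vertex {r} u) (index-vertex {r} v)))
  (identity-index r (vertex u) (vertex v))

-- The cycle of rim vertices

module Cycle (p : ℕ) where
  private
    r : ℕ
    r = suc p

  -- `next` copies the residue in `Next`; `prev` is given by cases, so that positions other than 0
  -- are lowered without modular arithmetic.
  next prev : Fin r → Fin r
  next i       = suc (toℕ i) mod r
  prev zero    = Fin.fromℕ p
  prev (suc i) = inject₁ i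

  toℕ-next : ∀ i → toℕ (next i) ≡ suc (toℕ i) % r
  toℕ-next i = Fin.toℕ-fromℕ< (m%n<n (suc (toℕ i)) r)

  next-cases : ∀ i → toℕ (next i) ≡ suc (toℕ i) ⊎ (toℕ i ≡ p × next i ≡ zero)
  next-cases i with suc (toℕ i) ℕ.<? r
  ... | yes lt = inj₁ (trans (toℕ-next i) (m<n⇒m%n≡m lt))
  ... | no ¬lt = inj₂ (i≡p , Fin.toℕ-injective (begin
    toℕ (next i)       ≡⟨ toℕ-next i ⟩
    suc (toℕ i) % r    ≡⟨ cong (λ k → suc k % r) i≡p ⟩
    r % r              ≡⟨ n%n≡0 r ⟩
    0                  ∎))
    where
    i≡p : toℕ i ≡ p
    i≡p = ℕ.suc-injective (ℕ.≤-antisym (Fin.toℕ<n i) (ℕ.≮⇒≥ ¬lt))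

  -- A function of the position that agrees at 0 and r does not see the
  -- wrap-around of the cycle.
  shift-next : ∀ {a} {A : Set a} (f : ℕ → A) → f r ≡ f 0 → ∀ i → f (toℕ (next i)) ≡ f (suc (toℕ i))
  shift-next f fr≡f0 i with next-cases i
  ... | inj₁ eq            = cong f eq
  ... | inj₂ (i≡p , eq) = trans (cong (f ∘ toℕ) eq) (trans (≡.sym fr≡f0) (cong (f ∘ suc) (≡.sym i≡p)))

  shift-prev : ∀ {a} {A : Set a} (f : ℕ → A) → f r ≡ f 0 → ∀ i → f (suc (toℕ (prev i))) ≡ f (toℕ i)
  shift-prev f fr≡f0 zero    = trans (cong (f ∘ suc) (Fin.toℕ-fromℕ p)) fr≡f0
  shift-prev f fr≡f0 (suc i) = cong (f ∘ suc) (Fin.toℕ-inject₁ i)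

  next-prev : ∀ i → next (prev i) ≡ i
  next-prev i = Fin.toℕ-injective (begin
    toℕ (next (prev i))       ≡⟨ toℕ-next (prev i) ⟩
    suc (toℕ (prev i)) % r    ≡⟨ shift-prev (_% r) (n%n≡0 r) i ⟩
    toℕ i % r                 ≡⟨ m<n⇒m%n≡m (Fin.toℕ<n i) ⟩
    toℕ i                     ∎)
  
  toℕ-prev : ∀ i {k} → toℕ i ≡ suc k → toℕ (prev i) ≡ k
  toℕ-prev (suc i) refl = Fin.toℕ-inject₁ i

  prev-next : ∀ i → prev (next i) ≡ i
  prev-next i with next-cases i
  ... | inj₁ eq         = Fin.toℕ-injective (toℕ-prev (next i) eq)
  ... | inj₂ (i≡p , eq) = trans (cong prev eq) (Fin.toℕ-injective (trans (Fin.toℕ-fromℕ p) (≡.sym i≡p)))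

  next≢id : 1 ≤ p → ∀ i → next i ≢ i
  next≢id 1≤p i eq with next-cases i
  ... | inj₁ i+1         = ℕ.1+n≢n (trans (≡.sym i+1) (cong toℕ eq))
  ... | inj₂ (i≡p , i+1) = ℕ.<⇒≢ 1≤p (trans (cong toℕ (trans (≡.sym i+1) eq)) i≡p)

  -- Without a wrap-around two steps raise the position by two; a wrap-around in either step would
  -- force p to be 0 or 1.
  next²≢id : 2 ≤ p → ∀ i → next (next i) ≢ i
  next²≢id 2≤p i eq with next-cases i | next-cases (next i)
  ... | inj₁ i+1         | inj₁ i+2         =
    ℕ.m≢1+n+m (toℕ i) {1} (trans (≡.sym (cong toℕ eq)) (trans i+2 (cong suc i+1)))
  ... | inj₁ i+1         | inj₂ (i+1≡p , i+2) =
    ℕ.<⇒≢ 2≤p (trans (cong (suc ∘ toℕ) (trans (≡.sym i+2) eq)) (trans (≡.sym i+1) i+1≡p))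
  ... | inj₂ (i≡p , i+1) | inj₁ i+2         =
    ℕ.<⇒≢ 2≤p (trans (trans (cong (suc ∘ toℕ) (≡.sym i+1)) (trans (≡.sym i+2) (cong toℕ eq))) i≡p)
  ... | inj₂ (i≡p , i+1) | inj₂ (i+1≡p , _) =
    ℕ.<⇒≢ (ℕ.<-trans (s≤s z≤n) 2≤p) (trans (cong toℕ (≡.sym i+1)) i+1≡p)

  next≢prev : 2 ≤ p → ∀ i → next i ≢ prev i
  next≢prev 2≤p i eq = next²≢id 2≤p (prev i) (trans (cong next (next-prev i)) eq)

  prev≢id : 1 ≤ p → ∀ i → prev i ≢ i
  prev≢id 1≤p i eq = next≢id 1≤p i (trans (cong next (≡.sym eq)) (next-prev i))

  rotation : Permutation r r
  rotation = permutation next prev next-prev prev-next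

  sum-next : ∀ (f : Fin r → ℚ) → sum (f ∘ next) ≡ sum f
  sum-next f = ≡.sym (sum-permute f rotation)

  sum-prev : ∀ (f : Fin r → ℚ) → sum (f ∘ prev) ≡ sum f
  sum-prev f = ≡.sym (sum-permute f (Perm.flip rotation))

  -- The matrix `S` as an operator. On an alternating sequence, with the sign factored out, it is
  -- minus the second difference, which is how it meets `β`.
  neighbourSum : (Fin r → ℚ) → Fin r → ℚ
  neighbourSum f i = fromℕ 2 * f i + f (next i) + f (prev i)

  neighbourSum-cong : ∀ {f g} → (∀ k → f k ≡ g k) → ∀ i → neighbourSum f i ≡ neighbourSum g i
  neighbourSum-cong f≗g i =
    cong₂ _+_ (cong₂ (λ a b → fromℕ 2 * a + b) (f≗g i) (f≗g (next i))) (f≗g (prev i))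

  neighbourSum-linear : ∀ a b f g i →
    neighbourSum (λ k → a * f k + b * g k) i ≡ a * neighbourSum f i + b * neighbourSum g i
  neighbourSum-linear a b f g i = lemma a b (f i) (f (next i)) (f (prev i)) (g i) (g (next i)) (g (prev i))
    where
    lemma : ∀ a b x y z u v w →
      fromℕ 2 * (a * x + b * u) + (a * y + b * v) + (a * z + b * w) ≡
      a * (fromℕ 2 * x + y + z) + b * (fromℕ 2 * u + v + w)
    lemma = solve-∀ ring

  -- Both shifts permute the rim and keep the total, so the weights 2, 1, 1 add up.
  sum-neighbourSum : ∀ f → sum (neighbourSum f) ≡ fromℕ 4 * sum f
  sum-neighbourSum f = begin
    sum (neighbourSum f)
      ≡⟨ ∑-distrib-+ (λ i → fromℕ 2 * f i + f (next i)) (f ∘ prev) ⟩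
    sum (λ i → fromℕ 2 * f i + f (next i)) + sum (f ∘ prev)
      ≡⟨ cong₂ _+_ (∑-distrib-+ (λ i → fromℕ 2 * f i) (f ∘ next)) (sum-prev f) ⟩
    sum (λ i → fromℕ 2 * f i) + sum (f ∘ next) + sum f
      ≡⟨ cong₂ (λ a b → a + b + sum f) (≡.sym (*-distribˡ-sum (fromℕ 2) f)) (sum-next f) ⟩
    fromℕ 2 * sum f + sum f + sum f
      ≡⟨ lemma (sum f) ⟩
    fromℕ 4 * sum f ∎
    where
    lemma : ∀ s → fromℕ 2 * s + s + s ≡ fromℕ 4 * s
    lemma = solve-∀ ring

  -- Circ(2 , 1 , 0 , ... , 0 , 1), acting as neighbourSum.
  S : Matrix r r
  S i k = fromℕ 2 * identity i k + identity (next i) k + identity (prev i) k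

  sum-S : ∀ i f → sum (λ k → S i k * f k) ≡ neighbourSum f i
  sum-S i f = begin
    sum (λ k → S i k * f k)
      ≡⟨ sum-cong-≗ (λ k → lemma (identity i k) (identity (next i) k) (identity (prev i) k) (f k)) ⟩
    sum (λ k → identity i k * (fromℕ 2 * f k) + identity (next i) k * f k + identity (prev i) k * f k)
      ≡⟨ ∑-distrib-+ (λ k → identity i k * (fromℕ 2 * f k) + identity (next i) k * f k)
          (λ k → identity (prev i) k * f k) ⟩
    sum (λ k → identity i k * (fromℕ 2 * f k) + identity (next i) k * f k) + sum
        (λ k → identity (prev i) k * f k)
      ≡⟨ cong₂ _+_ (∑-distrib-+ (λ k → identity i k * (fromℕ 2 * f k))
          (λ k → identity (next i) k * f k)) (sum-identity (prev i) f) ⟩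
    sum (λ k → identity i k * (fromℕ 2 * f k)) + sum (λ k → identity (next i) k * f k) + f (prev i)
      ≡⟨ cong₂ (λ a b → a + b + f (prev i)) (sum-identity i (λ k → fromℕ 2 * f k)) (sum-identity (next i) f) ⟩
    neighbourSum f i ∎
    where
    lemma : ∀ a b c x → (fromℕ 2 * a + b + c) * x ≡ a * (fromℕ 2 * x) + b * x + c * x
    lemma = solve-∀ ring

  -- With q = 2, 3, 4 this covers all blocks of the distance matrix away from the hub, up to the -2I
  -- of the pendant block.
  sum-const-S : ∀ q i f → sum (λ k → (q - S i k) * f k) ≡ q * sum f - neighbourSum f i
  sum-const-S q i f = begin
    sum (λ k → (q - S i k) * f k)
      ≡⟨ sum-cong-≗ (λ k → lemma q (S i k) (f k)) ⟩
    sum (λ k → q * f k + - 1ℚ * (S i k * f k))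
      ≡⟨ ∑-distrib-+ (λ k → q * f k) (λ k → - 1ℚ * (S i k * f k)) ⟩
    sum (λ k → q * f k) + sum (λ k → - 1ℚ * (S i k * f k))
      ≡⟨ cong₂ _+_ (*-distribˡ-sum q f) (*-distribˡ-sum (- 1ℚ) (λ k → S i k * f k)) ⟨
    q * sum f + - 1ℚ * sum (λ k → S i k * f k)
      ≡⟨ cong (λ s → q * sum f + - 1ℚ * s) (sum-S i f) ⟩
    q * sum f + - 1ℚ * neighbourSum f i
      ≡⟨ lemma₂ (q * sum f) (neighbourSum f i) ⟩
    q * sum f - neighbourSum f i ∎
    where
    lemma : ∀ a b x → (a - b) * x ≡ a * x + - 1ℚ * (b * x)
    lemma = solve-∀ ring
    lemma₂ : ∀ a b → a + - 1ℚ * b ≡ a - b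
    lemma₂ = solve-∀ ring

-- Alternating signs and the quadratic β

ε : ℕ → ℚ
ε zero    = 1ℚ
ε (suc k) = - ε k

fromℤ-ε : ∀ k → fromℤ (-1ℤ ℤ.^ k) ≡ ε k
fromℤ-ε zero    = refl
fromℤ-ε (suc k) = begin
  fromℤ (-1ℤ ℤ.* -1ℤ ℤ.^ k)   ≡⟨ fromℤ-* -1ℤ (-1ℤ ℤ.^ k) ⟩
  - 1ℚ * fromℤ (-1ℤ ℤ.^ k)    ≡⟨ cong (λ q → - 1ℚ * q) (fromℤ-ε k) ⟩
  - 1ℚ * ε k                  ≡⟨ lemma (ε k) ⟩
  - ε k                       ∎
  where
  lemma : ∀ e → - 1ℚ * e ≡ - e
  lemma = solve-∀ ring

ε-suc-suc : ∀ i j → ε (suc i) * ε (suc j) ≡ ε i * ε j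
ε-suc-suc i j = lemma (ε i) (ε j)
  where
  lemma : ∀ d e → - d * - e ≡ d * e
  lemma = solve-∀ ring

ε-+ : ∀ i j → ε (i ℕ.+ j) ≡ ε i * ε j
ε-+ zero    j = ≡.sym (ℚ.*-identityˡ (ε j))
ε-+ (suc i) j = trans (cong -_ (ε-+ i j)) (ℚ.neg-distribˡ-* (ε i) (ε j))

ε² : ∀ i → ε i * ε i ≡ 1ℚ
ε² zero    = refl
ε² (suc i) = trans (ε-suc-suc i i) (ε² i)

-- The distance has the parity of i + j. This factors the alternating part of a circulant as a
-- rank-one matrix.
ε-∣-∣ : ∀ i j → ε ∣ i - j ∣ ≡ ε i * ε j
ε-∣-∣ zero    j       = ≡.sym (ℚ.*-identityˡ (ε j))
ε-∣-∣ (suc i) zero    = ≡.sym (ℚ.*-identityʳ (ε (suc i)))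
ε-∣-∣ (suc i) (suc j) = trans (ε-∣-∣ i j) (≡.sym (ε-suc-suc i j))

-- The Kronecker delta on natural numbers, since the difference identities are proved before
-- positions are confined to the rim.
δ : ℕ → ℕ → ℚ
δ zero    zero    = 1ℚ
δ (suc i) (suc j) = δ i j
δ _       _       = 0ℚ

δ-identity : ∀ {n} (i j : Fin n) → δ (toℕ i) (toℕ j) ≡ identity i j
δ-identity zero    zero    = refl
δ-identity zero    (suc j) = refl
δ-identity (suc i) zero    = refl
δ-identity (suc i) (suc j) = δ-identity i j

δ-∣-∣ : ∀ i j → δ 0 ∣ i - j ∣ ≡ δ i j
δ-∣-∣ zero    zero    = refl
δ-∣-∣ zero    (suc j) = refl
δ-∣-∣ (suc i) zero    = refl
δ-∣-∣ (suc i) (suc j) = δ-∣-∣ i j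

fromℕ-∸ : ∀ {j k} → j ≤ k → fromℕ (k ∸ j) ≡ fromℕ k - fromℕ j
fromℕ-∸ {j} {k} j≤k = trans (lemma (fromℕ j) (fromℕ (k ∸ j)))
  (cong (_- fromℕ j) (trans (≡.sym (fromℕ-+ j (k ∸ j))) (cong fromℕ (ℕ.m+[n∸m]≡n j≤k))))
  where
  lemma : ∀ a b → b ≡ a + b - a
  lemma = solve-∀ ring

-- The bracket 2m² - 6(m - k)² + 7 of `α`, multiplied out. Rational arguments make the reflection d
-- ↦ 2M - d a polynomial identity.
β : ℚ → ℚ → ℚ
β M d = fromℕ 7 - fromℕ 4 * (M * M) + fromℕ 12 * (M * d) - fromℕ 6 * (d * d)

module _ where
  open +-*-Solver

  -- solve-∀ does not unfold β, hence this copy in the solver syntax.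
  βᵖ : ∀ {n} → Polynomial n → Polynomial n → Polynomial n
  βᵖ M d = con (fromℕ 7) :- con (fromℕ 4) :* (M :* M) :+ con (fromℕ 12) :* (M :* d) :- con (fromℕ 6) :* (d :* d)

  β-reflect : ∀ M d → β M (M + M - d) ≡ β M d
  β-reflect = solve 2 (λ M d → βᵖ M (M :+ M :- d) := βᵖ M d) refl

  β-vertexForm : ∀ e M d →
    e * - 1ℚ * (fromℕ 2 * (M * M) - fromℕ 6 * ((M - d) * (M - d)) + fromℕ 7) ≡ - (e * β M d)
  β-vertexForm = solve 3 (λ e M d →
    e :* :- con 1ℚ :* (con (fromℕ 2) :* (M :* M) :- con (fromℕ 6) :* ((M :- d) :* (M :- d)) :+ con (fromℕ 7)) :=
    :- (e :* βᵖ M d)) refl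

  -- With n = 1 + 2M, the exceptional first entry of `x` is the generic value -β at 0 raised by 6r.
  -- The surplus 6r becomes the identity matrix in `A`.
  β-diagonal : ∀ M → (1ℚ + (M + M)) * (1ℚ + (M + M)) + fromℕ 4 * (1ℚ + (M + M)) - fromℕ 12 ≡
                     fromℕ 6 * (M + M) * 1ℚ - 1ℚ * β M 0ℚ
  β-diagonal = solve 1 (λ M →
    (con 1ℚ :+ (M :+ M)) :* (con 1ℚ :+ (M :+ M)) :+ con (fromℕ 4) :* (con 1ℚ :+ (M :+ M)) :- con (fromℕ 12) :=
    con (fromℕ 6) :* (M :+ M) :* con 1ℚ :- con 1ℚ :* βᵖ M (con 0ℚ)) refl

  β-secondDifference : ∀ M d → β M (1ℚ + (1ℚ + d)) ≡ fromℕ 2 * β M (1ℚ + d) - β M d - fromℕ 12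
  β-secondDifference = solve 2 (λ M d → βᵖ M (con 1ℚ :+ (con 1ℚ :+ d)) :=
    con (fromℕ 2) :* βᵖ M (con 1ℚ :+ d) :- βᵖ M d :- con (fromℕ 12)) refl

  -- The slope at the corner d = 0. Both neighbours of the diagonal carry β(1), so this difference
  -- counts twice there.
  β-firstDifference₀ : ∀ M → β M 1ℚ ≡ β M 0ℚ + fromℕ 12 * M - fromℕ 6
  β-firstDifference₀ = solve 1 (λ M → βᵖ M (con 1ℚ) :=
    βᵖ M (con 0ℚ) :+ con (fromℕ 12) :* M :- con (fromℕ 6)) refl

-- Tₐ M a ∣ a ∣ is a discrete antiderivative of β M ∣ a ∣.
Tₐ : ℚ → ℚ → ℚ → ℚ
Tₐ M a d = (fromℕ 7 - fromℕ 4 * (M * M)) * a + fromℕ 6 * (M * (d * (a - 1ℚ))) - a * ((a - 1ℚ) * (a + a - 1ℚ))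

module _ where
  open +-*-Solver

  Tᵖ : ∀ {n} → Polynomial n → Polynomial n → Polynomial n → Polynomial n
  Tᵖ M a d = (con (fromℕ 7) :- con (fromℕ 4) :* (M :* M)) :* a :+
    con (fromℕ 6) :* (M :* (d :* (a :- con 1ℚ))) :- a :* ((a :- con 1ℚ) :* (a :+ a :- con 1ℚ))

  -- The absolute value is not polynomial in the offset, so each sign has its own identity; `0ℚ` is
  -- the value of `fromℕ zero` in `T`. The last summand of `Tₐ` handles -6d², as a(a - 1)(2a - 1) is
  -- six times the sum of the squares below a.
  Tₐ-step⁺ : ∀ M d → Tₐ M (1ℚ + d - 0ℚ) (1ℚ + d) - Tₐ M (d - 0ℚ) d ≡ β M d
  Tₐ-step⁺ = solve 2 (λ M d → Tᵖ M (con 1ℚ :+ d :- con 0ℚ) (con 1ℚ :+ d) :- Tᵖ M (d :- con 0ℚ) d := βᵖ M d) refl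

  Tₐ-step⁻ : ∀ M d → Tₐ M (1ℚ - (1ℚ + d)) d - Tₐ M (0ℚ - (1ℚ + d)) (1ℚ + d) ≡ β M (1ℚ + d)
  Tₐ-step⁻ = solve 2 (λ M d → Tᵖ M (con 1ℚ :- (con 1ℚ :+ d)) d :- Tᵖ M (con 0ℚ :- (con 1ℚ :+ d))
      (con 1ℚ :+ d) := βᵖ M (con 1ℚ :+ d)) refl

  -- The end values of the telescoping sum in column d, whose offsets run from -d to 2M - d. The
  -- dependence on d cancels, as it must for column sums of a circulant.
  Tₐ-period : ∀ M d → Tₐ M (M + M - d) (M + M - d) - Tₐ M (0ℚ - d) d ≡ fromℕ 12 * M
  Tₐ-period = solve 2 (λ M d → Tᵖ M (M :+ M :- d) (M :+ M :- d) :- Tᵖ M (con 0ℚ :- d) d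
      := con (fromℕ 12) :* M) refl

β-fromℕ-secondDifference : ∀ M k →
  β M (fromℕ (suc (suc k))) ≡ fromℕ 2 * β M (fromℕ (suc k)) - β M (fromℕ k) - fromℕ 12
β-fromℕ-secondDifference M k = begin
  β M (fromℕ (suc (suc k)))
    ≡⟨ cong (β M) (trans (fromℕ-suc (suc k)) (cong (λ q → 1ℚ + q) (fromℕ-suc k))) ⟩
  β M (1ℚ + (1ℚ + fromℕ k))
    ≡⟨ β-secondDifference M (fromℕ k) ⟩
  fromℕ 2 * β M (1ℚ + fromℕ k) - β M (fromℕ k) - fromℕ 12
    ≡⟨ cong (λ q → fromℕ 2 * β M q - β M (fromℕ k) - fromℕ 12) (fromℕ-suc k) ⟨
  fromℕ 2 * β M (fromℕ (suc k)) - β M (fromℕ k) - fromℕ 12 ∎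

module _ (m : ℕ) where
  private
    M : ℚ
    M = fromℕ m

  K : ℕ → ℕ → ℚ
  K i j = ε i * ε j * β M (fromℕ ∣ i - j ∣)

  K-suc : ∀ i j → K (suc i) (suc j) ≡ K i j
  K-suc i j = cong (_* β M (fromℕ ∣ i - j ∣)) (ε-suc-suc i j)

  K-sym : ∀ i j → K i j ≡ K j i
  K-sym i j = cong₂ (λ e d → e * β M (fromℕ d)) (ℚ.*-comm (ε i) (ε j)) (ℕ.∣-∣-comm i j)

  -- The centre is raised to (i + 1, j + 1) so that the row before it exists in ℕ. `K` is constant
  -- along diagonals, so the recursion lowers both indices until one is 0: the corner of β if both
  -- are, a plain second difference otherwise.
  K-secondDifference : ∀ i j →
    fromℕ 2 * K (suc i) (suc j) + K (suc (suc i)) (suc j) + K i (suc j) ≡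
    fromℕ 12 * (ε i * ε j) - fromℕ 12 * ((M + M) * δ i j)
  K-secondDifference zero    zero    = lemma M (β M 0ℚ) (β M 1ℚ) (β-firstDifference₀ M)
    where
    -- The values of `β` enter as variables tied by an equation; matching on `refl` substitutes it
    -- and leaves a pure ring identity.
    lemma : ∀ M b₀ b₁ → b₁ ≡ b₀ + fromℕ 12 * M - fromℕ 6 →
      fromℕ 2 * (- 1ℚ * - 1ℚ * b₀) + - - 1ℚ * - 1ℚ * b₁ + 1ℚ * - 1ℚ * b₁ ≡
      fromℕ 12 * (1ℚ * 1ℚ) - fromℕ 12 * ((M + M) * 1ℚ)
    lemma M b₀ _ refl = expand M b₀
      where
      expand : ∀ M b₀ →
        fromℕ 2 * (- 1ℚ * - 1ℚ * b₀) + - - 1ℚ * - 1ℚ * (b₀ + fromℕ 12 * M - fromℕ 6) +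
          1ℚ * - 1ℚ * (b₀ + fromℕ 12 * M - fromℕ 6) ≡
        fromℕ 12 * (1ℚ * 1ℚ) - fromℕ 12 * ((M + M) * 1ℚ)
      expand = solve-∀ ring
  K-secondDifference zero    (suc j) =
    lemma M (ε j) _ _ _ (β-fromℕ-secondDifference M j)
    where
    lemma : ∀ M e b₀ b₁ b₂ → b₂ ≡ fromℕ 2 * b₁ - b₀ - fromℕ 12 →
      fromℕ 2 * (- 1ℚ * - - e * b₁) + - - 1ℚ * - - e * b₀ + 1ℚ * - - e * b₂ ≡
      fromℕ 12 * (1ℚ * - e) - fromℕ 12 * ((M + M) * 0ℚ)
    lemma M e b₀ b₁ _ refl = expand M e b₀ b₁
      where
      expand : ∀ M e b₀ b₁ →
        fromℕ 2 * (- 1ℚ * - - e * b₁) + - - 1ℚ * - - e * b₀ +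
          1ℚ * - - e * (fromℕ 2 * b₁ - b₀ - fromℕ 12) ≡
        fromℕ 12 * (1ℚ * - e) - fromℕ 12 * ((M + M) * 0ℚ)
      expand = solve-∀ ring
  K-secondDifference (suc i) zero    =
    lemma M (ε i) _ _ _ (trans (β-fromℕ-secondDifference M i)
      (cong (λ k → fromℕ 2 * β M (fromℕ (suc i)) - β M (fromℕ k) - fromℕ 12) (≡.sym (ℕ.∣-∣-identityʳ i))))
    where
    lemma : ∀ M e b₀ b₁ b₂ → b₂ ≡ fromℕ 2 * b₁ - b₀ - fromℕ 12 →
      fromℕ 2 * (- - e * - 1ℚ * b₁) + - - - e * - 1ℚ * b₂ + - e * - 1ℚ * b₀ ≡
      fromℕ 12 * (- e * 1ℚ) - fromℕ 12 * ((M + M) * 0ℚ)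
    lemma M e b₀ b₁ _ refl = expand M e b₀ b₁
      where
      expand : ∀ M e b₀ b₁ →
        fromℕ 2 * (- - e * - 1ℚ * b₁) + - - - e * - 1ℚ * (fromℕ 2 * b₁ - b₀ - fromℕ 12) +
          - e * - 1ℚ * b₀ ≡
        fromℕ 12 * (- e * 1ℚ) - fromℕ 12 * ((M + M) * 0ℚ)
      expand = solve-∀ ring
  K-secondDifference (suc i) (suc j) = begin
    fromℕ 2 * K (suc (suc i)) (suc (suc j)) + K (suc (suc (suc i))) (suc (suc j)) + K (suc i) (suc (suc j))
      ≡⟨ cong₂ _+_ (cong₂ (λ a b → fromℕ 2 * a + b) (K-suc (suc i) (suc j))
          (K-suc (suc (suc i)) (suc j))) (K-suc i (suc j)) ⟩
    fromℕ 2 * K (suc i) (suc j) + K (suc (suc i)) (suc j) + K i (suc j)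
      ≡⟨ K-secondDifference i j ⟩
    fromℕ 12 * (ε i * ε j) - fromℕ 12 * ((M + M) * δ i j)
      ≡⟨ cong (λ e → fromℕ 12 * e - fromℕ 12 * ((M + M) * δ i j)) (ε-suc-suc i j) ⟨
    fromℕ 12 * (ε (suc i) * ε (suc j)) - fromℕ 12 * ((M + M) * δ i j) ∎

  T : ℕ → ℕ → ℚ
  T i j = Tₐ M (fromℕ i - fromℕ j) (fromℕ ∣ i - j ∣)

  T-suc : ∀ i j → T (suc i) (suc j) ≡ T i j
  T-suc i j = cong (λ a → Tₐ M a (fromℕ ∣ i - j ∣))
    (trans (cong₂ _-_ (fromℕ-suc i) (fromℕ-suc j)) (lemma (fromℕ i) (fromℕ j)))
    where
    lemma : ∀ a b → 1ℚ + a - (1ℚ + b) ≡ a - b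
    lemma = solve-∀ ring

  T-step : ∀ i j → T (suc i) j - T i j ≡ β M (fromℕ ∣ i - j ∣)
  T-step i       zero    = subst
    (λ k → Tₐ M (fromℕ (suc i) - 0ℚ) (fromℕ (suc i)) - Tₐ M (fromℕ i - 0ℚ) (fromℕ k) ≡ β M (fromℕ k))
    (≡.sym (ℕ.∣-∣-identityʳ i))
    (subst (λ d → Tₐ M (d - 0ℚ) d - Tₐ M (fromℕ i - 0ℚ) (fromℕ i) ≡ β M (fromℕ i))
      (≡.sym (fromℕ-suc i)) (Tₐ-step⁺ M (fromℕ i)))
  T-step zero    (suc j) =
    subst (λ d → Tₐ M (1ℚ - d) (fromℕ j) - Tₐ M (0ℚ - d) d ≡ β M d)
      (≡.sym (fromℕ-suc j)) (Tₐ-step⁻ M (fromℕ j))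
  T-step (suc i) (suc j) = trans (cong₂ _-_ (T-suc (suc i) j) (T-suc i j)) (T-step i j)

  module _ {r : ℕ} (r≡m+m : r ≡ m ℕ.+ m) where

    fromℕ-r : fromℕ r ≡ M + M
    fromℕ-r = trans (cong fromℕ r≡m+m) (fromℕ-+ m m)

    -- Here the evenness of the rim enters: alternating signs close up around the cycle.
    ε-r : ε r ≡ 1ℚ
    ε-r = trans (cong ε r≡m+m) (trans (ε-+ m m) (ε² m))

    fromℕ-∸ʳ : ∀ {k} → k ≤ r → fromℕ (r ∸ k) ≡ M + M - fromℕ k
    fromℕ-∸ʳ {k} k≤r = trans (fromℕ-∸ k≤r) (cong (_- fromℕ k) fromℕ-r)

    ε-∸ : ∀ {k} → k ≤ r → ε (r ∸ k) ≡ ε k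
    ε-∸ {k} k≤r = begin
      ε (r ∸ k)      ≡⟨ cong ε (ℕ.m≤n⇒∣n-m∣≡n∸m k≤r) ⟨
      ε ∣ r - k ∣    ≡⟨ ε-∣-∣ r k ⟩
      ε r * ε k      ≡⟨ cong (_* ε k) ε-r ⟩
      1ℚ * ε k       ≡⟨ ℚ.*-identityˡ (ε k) ⟩
      ε k            ∎

    β-∸ : ∀ {k} → k ≤ r → β M (fromℕ (r ∸ k)) ≡ β M (fromℕ k)
    β-∸ {k} k≤r = trans (cong (β M) (fromℕ-∸ʳ k≤r)) (β-reflect M (fromℕ k))

    -- The sign returns because r is even, and the quadratic because it is symmetric about M. This
    -- carries the difference identity across the wrap-around.
    K-periodic : ∀ {j} → j ≤ r → K r j ≡ K 0 j
    K-periodic {j} j≤r = begin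
      ε r * ε j * β M (fromℕ ∣ r - j ∣)
        ≡⟨ cong₂ (λ e k → e * ε j * β M (fromℕ k)) ε-r (ℕ.m≤n⇒∣n-m∣≡n∸m j≤r) ⟩
      1ℚ * ε j * β M (fromℕ (r ∸ j))
        ≡⟨ cong (λ b → 1ℚ * ε j * b) (β-∸ j≤r) ⟩
      1ℚ * ε j * β M (fromℕ j) ∎

    sum-β : ∀ {j} → j ≤ r → sum {r} (λ i → β M (fromℕ ∣ toℕ i - j ∣)) ≡ fromℕ 6 * fromℕ r
    sum-β {j} j≤r = begin
      sum {r} (λ i → β M (fromℕ ∣ toℕ i - j ∣))
        ≡⟨ sum-cong-≗ {r} (λ i → T-step (toℕ i) j) ⟨
      sum {r} (λ i → T (suc (toℕ i)) j - T (toℕ i) j)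
        ≡⟨ sum-telescope r (λ i → T i j) ⟩
      T r j - T 0 j
        ≡⟨ cong₂ (λ a k → Tₐ M (a - fromℕ j) (fromℕ k) - T 0 j) fromℕ-r (ℕ.m≤n⇒∣n-m∣≡n∸m j≤r) ⟩
      Tₐ M (M + M - fromℕ j) (fromℕ (r ∸ j)) - T 0 j
        ≡⟨ cong (λ d → Tₐ M (M + M - fromℕ j) d - T 0 j) (fromℕ-∸ʳ j≤r) ⟩
      Tₐ M (M + M - fromℕ j) (M + M - fromℕ j) - T 0 j
        ≡⟨ Tₐ-period M (fromℕ j) ⟩
      fromℕ 12 * M
        ≡⟨ lemma M ⟩
      fromℕ 6 * (M + M)
        ≡⟨ cong (λ q → fromℕ 6 * q) fromℕ-r ⟨
      fromℕ 6 * fromℕ r ∎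
      where
      lemma : ∀ M → fromℕ 12 * M ≡ fromℕ 6 * (M + M)
      lemma = solve-∀ ring

-- The circulant K on the cycle

module CycleMatrices (p m : ℕ) (r≡m+m : suc p ≡ m ℕ.+ m) where
  open Cycle p
  private
    r : ℕ
    r = suc p

    R : ℚ
    R = fromℕ r

  εᶠ : Fin r → ℚ
  εᶠ i = ε (toℕ i)

  Kᶠ : Matrix r r
  Kᶠ i j = K m (toℕ i) (toℕ j)

  -- Periodicity removes the wrap-around from both neighbours, after which every index is raised by
  -- one to match `K-secondDifference`.
  neighbourSum-K : ∀ i j →
    neighbourSum (λ k → Kᶠ k j) i ≡ fromℕ 12 * (εᶠ i * εᶠ j) - fromℕ 12 * (R * identity i j)
  neighbourSum-K i j = begin
    fromℕ 2 * K m (toℕ i) (toℕ j) + K m (toℕ (next i)) (toℕ j) + K m (toℕ (prev i)) (toℕ j)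
      ≡⟨ cong₂ _+_ (cong₂ (λ a b → fromℕ 2 * a + b) (≡.sym (K-suc m (toℕ i) (toℕ j))) K-next) K-prev ⟩
    fromℕ 2 * K m (suc (toℕ i)) (suc (toℕ j)) + K m (suc (suc (toℕ i))) (suc (toℕ j)) + K m (toℕ i)
        (suc (toℕ j))
      ≡⟨ K-secondDifference m (toℕ i) (toℕ j) ⟩
    fromℕ 12 * (εᶠ i * εᶠ j) - fromℕ 12 * ((fromℕ m + fromℕ m) * δ (toℕ i) (toℕ j))
      ≡⟨ cong₂ (λ q d → fromℕ 12 * (εᶠ i * εᶠ j) - fromℕ 12 * (q * d)) (≡.sym (fromℕ-r m r≡m+m))
          (δ-identity i j) ⟩
    fromℕ 12 * (εᶠ i * εᶠ j) - fromℕ 12 * (R * identity i j) ∎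
    where
    K-next : K m (toℕ (next i)) (toℕ j) ≡ K m (suc (suc (toℕ i))) (suc (toℕ j))
    K-next = trans
      (shift-next (λ k → K m k (toℕ j)) (K-periodic m r≡m+m (ℕ.<⇒≤ (Fin.toℕ<n j))) i)
      (≡.sym (K-suc m (suc (toℕ i)) (toℕ j)))

    K-prev : K m (toℕ (prev i)) (toℕ j) ≡ K m (toℕ i) (suc (toℕ j))
    K-prev = trans
      (≡.sym (K-suc m (toℕ (prev i)) (toℕ j)))
      -- The raised column j + 1 may equal r, hence the bound j ≤ r in `K-periodic`.
      (shift-prev (λ k → K m k (suc (toℕ j))) (K-periodic m r≡m+m (Fin.toℕ<n j)) i)

  neighbourSum-ε : ∀ i → neighbourSum εᶠ i ≡ 0ℚ
  neighbourSum-ε i = begin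
    fromℕ 2 * εᶠ i + εᶠ (next i) + εᶠ (prev i)
      ≡⟨ cong₂ (λ a b → fromℕ 2 * εᶠ i + a + b) (shift-next ε (ε-r m r≡m+m) i) ε-prev ⟩
    fromℕ 2 * εᶠ i + - εᶠ i + - εᶠ i
      ≡⟨ lemma (εᶠ i) ⟩
    0ℚ ∎
    where
    lemma : ∀ e → fromℕ 2 * e + - e + - e ≡ 0ℚ
    lemma = solve-∀ ring
    ε-prev : εᶠ (prev i) ≡ - εᶠ i
    ε-prev = trans (≡.sym (-‿involutive (εᶠ (prev i)))) (cong -_ (shift-prev ε (ε-r m r≡m+m) i))

  -- `S` multiplies totals by 4, so a total can be read off after applying it.
  sum-via-neighbourSum : ∀ f q → sum (neighbourSum f) ≡ fromℕ 4 * q → sum f ≡ q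
  sum-via-neighbourSum f q eq = begin
    sum f                                 ≡⟨ lemma (sum f) ⟩
    + 1 / 4 * (fromℕ 4 * sum f)           ≡⟨ cong (λ s → + 1 / 4 * s) (trans (≡.sym (sum-neighbourSum f)) eq) ⟩
    + 1 / 4 * (fromℕ 4 * q)               ≡⟨ lemma q ⟨
    q                                     ∎
    where
    lemma : ∀ s → s ≡ + 1 / 4 * (fromℕ 4 * s)
    lemma = solve-∀ ring

  sum-ε : sum εᶠ ≡ 0ℚ
  sum-ε = sum-via-neighbourSum εᶠ 0ℚ (begin
    sum (neighbourSum εᶠ)      ≡⟨ sum-cong-≗ neighbourSum-ε ⟩
    sum {r} (λ _ → 0ℚ)         ≡⟨ sum-replicate-zero r ⟩
    0ℚ                         ∎)

  sum-K : ∀ j → sum (λ i → Kᶠ i j) ≡ - (fromℕ 3 * R)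
  sum-K j = sum-via-neighbourSum (λ i → Kᶠ i j) (- (fromℕ 3 * R)) (begin
    sum (neighbourSum (λ i → Kᶠ i j))
      ≡⟨ sum-cong-≗ (λ i → trans (neighbourSum-K i j) (lemma (εᶠ i) (εᶠ j) R (identity i j))) ⟩
    sum (λ i → fromℕ 12 * εᶠ j * εᶠ i + - (fromℕ 12 * R) * identity i j)
      ≡⟨ sum-linear (fromℕ 12 * εᶠ j) (- (fromℕ 12 * R)) εᶠ (λ i → identity i j) ⟩
    fromℕ 12 * εᶠ j * sum εᶠ + - (fromℕ 12 * R) * sum (λ i → identity i j)
      ≡⟨ cong₂ (λ a b → fromℕ 12 * εᶠ j * a + - (fromℕ 12 * R) * b) sum-ε (sum-identity-column j) ⟩
    fromℕ 12 * εᶠ j * 0ℚ + - (fromℕ 12 * R) * 1ℚ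
      ≡⟨ lemma₂ (εᶠ j) R ⟩
    fromℕ 4 * - (fromℕ 3 * R) ∎)
    where
    lemma : ∀ d e R q → fromℕ 12 * (d * e) - fromℕ 12 * (R * q) ≡ fromℕ 12 * e * d + - (fromℕ 12 * R) * q
    lemma = solve-∀ ring
    lemma₂ : ∀ e R → fromℕ 12 * e * 0ℚ + - (fromℕ 12 * R) * 1ℚ ≡ fromℕ 4 * - (fromℕ 3 * R)
    lemma₂ = solve-∀ ring

  -- The sign of row i is squared away, leaving the total of β, which `sum-β` obtains by
  -- telescoping.
  sum-ε-K : ∀ j → sum (λ i → εᶠ i * Kᶠ i j) ≡ fromℕ 6 * R * εᶠ j
  sum-ε-K j = begin
    sum (λ i → εᶠ i * Kᶠ i j)
      ≡⟨ sum-cong-≗ (λ i → trans (lemma (εᶠ i) (εᶠ j) (b i)) (cong (λ q → q * εᶠ j * b i) (ε² (toℕ i)))) ⟩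
    sum (λ i → 1ℚ * εᶠ j * b i)
      ≡⟨ *-distribˡ-sum (1ℚ * εᶠ j) b ⟨
    1ℚ * εᶠ j * sum b
      ≡⟨ cong (λ s → 1ℚ * εᶠ j * s) (sum-β m r≡m+m (ℕ.<⇒≤ (Fin.toℕ<n j))) ⟩
    1ℚ * εᶠ j * (fromℕ 6 * R)
      ≡⟨ lemma₂ (εᶠ j) R ⟩
    fromℕ 6 * R * εᶠ j ∎
    where
    b : Fin r → ℚ
    b i = β (fromℕ m) (fromℕ ∣ toℕ i - toℕ j ∣)
    lemma : ∀ d e b → d * (d * e * b) ≡ d * d * e * b
    lemma = solve-∀ ring
    lemma₂ : ∀ e R → 1ℚ * e * (fromℕ 6 * R) ≡ fromℕ 6 * R * e
    lemma₂ = solve-∀ ring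

-- The residue of j - i is the distance or r minus the distance, according to the order of i and j.
-- Evenness is asked only for 0 < k < r, because entry 0 of `x` and of `y` is exceptional.
Circ-even : ∀ {r} .{{_ : NonZero r}} (f : ℕ → ℚ) → (∀ {k} → 0 < k → k < r → f (r ∸ k) ≡ f k) →
            ∀ (i j : Fin r) → Circ (f ∘ toℕ) i j ≡ f ∣ toℕ i - toℕ j ∣
Circ-even {r} f even i j = trans (cong f (Fin.toℕ-fromℕ< (m%n<n (toℕ j ℕ.+ (r ∸ toℕ i)) r)))
    (go (ℕ.≤-<-connex (toℕ i) (toℕ j)))
  where
  i≤r : toℕ i ≤ r
  i≤r = ℕ.<⇒≤ (Fin.toℕ<n i)
  j≤r : toℕ j ≤ r
  j≤r = ℕ.<⇒≤ (Fin.toℕ<n j)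
  go : toℕ i ≤ toℕ j ⊎ toℕ j < toℕ i → f ((toℕ j ℕ.+ (r ∸ toℕ i)) % r) ≡ f ∣ toℕ i - toℕ j ∣
  go (inj₁ i≤j) = cong f (begin
    (toℕ j ℕ.+ (r ∸ toℕ i)) % r      ≡⟨ cong (_% r) (ℕ.+-∸-assoc (toℕ j) i≤r) ⟨
    (toℕ j ℕ.+ r ∸ toℕ i) % r        ≡⟨ cong (_% r) (ℕ.+-∸-comm r i≤j) ⟩
    (toℕ j ∸ toℕ i ℕ.+ r) % r        ≡⟨ [m+n]%n≡m%n (toℕ j ∸ toℕ i) r ⟩
    (toℕ j ∸ toℕ i) % r              ≡⟨ m<n⇒m%n≡m (ℕ.≤-<-trans (ℕ.m∸n≤m (toℕ j) (toℕ i)) (Fin.toℕ<n j)) ⟩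
    toℕ j ∸ toℕ i                    ≡⟨ ℕ.m≤n⇒∣m-n∣≡n∸m i≤j ⟨
    ∣ toℕ i - toℕ j ∣                ∎)
  go (inj₂ j<i) = begin
    f ((toℕ j ℕ.+ (r ∸ toℕ i)) % r)  ≡⟨ cong (λ k → f (k % r)) eq ⟩
    f ((r ∸ (toℕ i ∸ toℕ j)) % r)    ≡⟨ cong f (m<n⇒m%n≡m (ℕ.∸-monoʳ-< 0<d (ℕ.<⇒≤ d<r))) ⟩
    f (r ∸ (toℕ i ∸ toℕ j))          ≡⟨ even 0<d d<r ⟩
    f (toℕ i ∸ toℕ j)                ≡⟨ cong f (ℕ.m≤n⇒∣n-m∣≡n∸m (ℕ.<⇒≤ j<i)) ⟨
    f ∣ toℕ i - toℕ j ∣              ∎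
    where
    0<d : 0 < toℕ i ∸ toℕ j
    0<d = ℕ.m<n⇒0<n∸m j<i
    d<r : toℕ i ∸ toℕ j < r
    d<r = ℕ.≤-<-trans (ℕ.m∸n≤m (toℕ i) (toℕ j)) (Fin.toℕ<n i)
    eq : toℕ j ℕ.+ (r ∸ toℕ i) ≡ r ∸ (toℕ i ∸ toℕ j)
    eq = begin
      toℕ j ℕ.+ (r ∸ toℕ i)                          ≡⟨ ℕ.+-∸-assoc (toℕ j) i≤r ⟨
      toℕ j ℕ.+ r ∸ toℕ i                            ≡⟨ cong (toℕ j ℕ.+ r ∸_) (ℕ.m+[n∸m]≡n (ℕ.<⇒≤ j<i)) ⟨
      toℕ j ℕ.+ r ∸ (toℕ j ℕ.+ (toℕ i ∸ toℕ j))      ≡⟨ ℕ.[m+n]∸[m+o]≡n∸o (toℕ j) r (toℕ i ∸ toℕ j) ⟩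
      r ∸ (toℕ i ∸ toℕ j)                            ∎

-- Distances in the helm graph

module _ {N : ℕ} {_~_ : Rel (Fin N) 0ℓ} (_~?_ : Decidable _~_) where
  open Distance _~?_

  -- The invariant is k ≤ d ≤ k + fuel: minimality of d forbids stopping earlier, and the walk of
  -- length d forces a stop there.
  search-least : ∀ {i j d} → Walk d i j → (∀ k → Walk k i j → d ≤ k) →
                 ∀ fuel k → k ≤ d → d ≤ k ℕ.+ fuel → search i j fuel k ≡ d
  search-least         w least zero       k k≤d d≤k   =
    ℕ.≤-antisym k≤d (ℕ.≤-trans d≤k (ℕ.≤-reflexive (ℕ.+-identityʳ k)))
  search-least {i} {j} w least (suc fuel) k k≤d d≤k+f with walk? k i j
  ... | yes w′ = ℕ.≤-antisym k≤d (least k w′)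
  ... | no ¬w  = search-least w least fuel (suc k)
    (ℕ.≤∧≢⇒< k≤d λ { refl → ¬w w })
    (ℕ.≤-trans d≤k+f (ℕ.≤-reflexive (ℕ.+-suc k fuel)))

  dist-least : ∀ {i j d} → Walk d i j → (∀ k → Walk k i j → d ≤ k) → d ≤ N → dist i j ≡ d
  dist-least w least d≤N = search-least w least N 0 z≤n d≤N

module HelmDistance (p : ℕ) (2≤p : 2 ≤ p) where
  private
    r : ℕ
    r = suc p
  open Cycle p
  open Rim r

  -- The default is 2 because the hub joins any two rim vertices.
  rimDist : Fin r → Fin r → ℕ
  rimDist i j =
    if does (i ≟ j) then 0 else
    if does (next i ≟ j) then 1 else
    if does (prev i ≟ j) then 1 else 2

  -- The exceptional diagonal is the source of -2I in the pendant block.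
  pendantDist : Fin r → Fin r → ℕ
  pendantDist i j = if does (i ≟ j) then 0 else 2 ℕ.+ rimDist i j

  helmDist : Vertex r → Vertex r → ℕ
  helmDist hub         hub         = 0
  helmDist hub         (rim _)     = 1
  helmDist hub         (pendant _) = 2
  helmDist (rim _)     hub         = 1
  helmDist (rim i)     (rim j)     = rimDist i j
  helmDist (rim i)     (pendant j) = 1 ℕ.+ rimDist i j
  helmDist (pendant _) hub         = 2
  helmDist (pendant i) (rim j)     = 1 ℕ.+ rimDist i j
  helmDist (pendant i) (pendant j) = pendantDist i j

  Next⇒next : ∀ {i j} → Next i j → next i ≡ j
  Next⇒next {i} j≡ = Fin.toℕ-injective (trans (toℕ-next i) (≡.sym j≡))

  next⇒Next : ∀ {i j} → next i ≡ j → Next i j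
  next⇒Next {i} refl = toℕ-next i

  rimAdjacent⇒ : ∀ {i j} → Adjacent (rim i) (rim j) → next i ≡ j ⊎ prev i ≡ j
  rimAdjacent⇒     (inj₁ n) = inj₁ (Next⇒next n)
  rimAdjacent⇒ {j = j} (inj₂ n) = inj₂ (trans (cong prev (≡.sym (Next⇒next n))) (prev-next j))

  rimDist-refl : ∀ i → rimDist i i ≡ 0
  rimDist-refl i with i ≟ i
  ... | yes _  = refl
  ... | no i≢i = contradiction refl i≢i

  rimDist≤2 : ∀ i j → rimDist i j ≤ 2
  rimDist≤2 i j with i ≟ j | next i ≟ j | prev i ≟ j
  ... | yes _ | _     | _     = z≤n
  ... | no _  | yes _ | _     = s≤s z≤n
  ... | no _  | no _  | yes _ = s≤s z≤n
  ... | no _  | no _  | no _  = ℕ.≤-refl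

  rimDist-adjacent : ∀ {i j} → Adjacent (rim i) (rim j) → rimDist i j ≤ 1
  rimDist-adjacent {i} {j} i~j with i ≟ j | next i ≟ j | prev i ≟ j | rimAdjacent⇒ i~j
  ... | yes _ | _      | _      | _       = z≤n
  ... | no _  | yes _  | _      | _       = ℕ.≤-refl
  ... | no _  | no _   | yes _  | _       = ℕ.≤-refl
  ... | no _  | no ¬eq | no _   | inj₁ eq = contradiction eq ¬eq
  ... | no _  | no _   | no ¬eq | inj₂ eq = contradiction eq ¬eq

  -- If l is not j, the right side is already at least 2, the largest value of `rimDist`.
  rimDist-lipschitz : ∀ {i l} j → Adjacent (rim i) (rim l) → rimDist i j ≤ suc (rimDist l j)
  rimDist-lipschitz {i} {l} j i~l with l ≟ j | next l ≟ j | prev l ≟ j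
  ... | yes refl | _     | _     = rimDist-adjacent i~l
  ... | no _     | yes _ | _     = rimDist≤2 i j
  ... | no _     | no _  | yes _ = rimDist≤2 i j
  ... | no _     | no _  | no _  = ℕ.m≤n⇒m≤1+n (rimDist≤2 i j)

  pendantDist-refl : ∀ i → pendantDist i i ≡ 0
  pendantDist-refl i with i ≟ i
  ... | yes _  = refl
  ... | no i≢i = contradiction refl i≢i

  pendantDist≤ : ∀ i j → pendantDist i j ≤ 2 ℕ.+ rimDist i j
  pendantDist≤ i j with i ≟ j
  ... | yes _ = z≤n
  ... | no _  = ℕ.≤-refl

  rimDist≤pendantDist : ∀ i j → rimDist i j ≤ pendantDist i j
  rimDist≤pendantDist i j with i ≟ j
  ... | yes _ = z≤n
  ... | no _  = ℕ.m≤n+m _ 2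

  helmDist-refl : ∀ a → helmDist a a ≡ 0
  helmDist-refl hub         = refl
  helmDist-refl (rim i)     = rimDist-refl i
  helmDist-refl (pendant i) = pendantDist-refl i

  -- The lower bound on distances: with the zero diagonal, induction along a walk shows that none is
  -- shorter than `helmDist`.
  helmDist-lipschitz : ∀ a b c → Adjacent a b → helmDist a c ≤ suc (helmDist b c)
  helmDist-lipschitz hub         (rim i)     hub         _    = z≤n
  helmDist-lipschitz hub         (rim i)     (rim j)     _    = s≤s z≤n
  helmDist-lipschitz hub         (rim i)     (pendant j) _    = s≤s (s≤s z≤n)
  helmDist-lipschitz (rim i)     hub         hub         _    = ℕ.≤-refl
  helmDist-lipschitz (rim i)     hub         (rim j)     _    = rimDist≤2 i j
  helmDist-lipschitz (rim i)     hub         (pendant j) _    = s≤s (rimDist≤2 i j)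
  helmDist-lipschitz (rim i)     (rim l)     hub         _    = s≤s z≤n
  helmDist-lipschitz (rim i)     (rim l)     (rim j)     i~l  = rimDist-lipschitz j i~l
  helmDist-lipschitz (rim i)     (rim l)     (pendant j) i~l  = s≤s (rimDist-lipschitz j i~l)
  helmDist-lipschitz (rim i)     (pendant i) hub         refl = s≤s z≤n
  helmDist-lipschitz (rim i)     (pendant i) (rim j)     refl = ℕ.m≤n+m _ 2
  helmDist-lipschitz (rim i)     (pendant i) (pendant j) refl = s≤s (rimDist≤pendantDist i j)
  helmDist-lipschitz (pendant i) (rim i)     hub         refl = ℕ.≤-refl
  helmDist-lipschitz (pendant i) (rim i)     (rim j)     refl = ℕ.≤-refl
  helmDist-lipschitz (pendant i) (rim i)     (pendant j) refl = pendantDist≤ i j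

  -- Walks on vertices instead of indices, so that adjacency reduces on constructors.
  VertexWalk : ℕ → Rel (Vertex r) 0ℓ
  VertexWalk zero    a b = a ≡ b
  VertexWalk (suc k) a b = ∃ λ c → Adjacent a c × VertexWalk k c b

  snoc : ∀ k a b c → VertexWalk k a b → Adjacent b c → VertexWalk (suc k) a c
  snoc zero    a b c refl          b~c = c , b~c , refl
  snoc (suc k) a b c (d , a~d , w) b~c = d , a~d , snoc k d b c w b~c

  rimWalk : ∀ i j → VertexWalk (rimDist i j) (rim i) (rim j)
  rimWalk i j with i ≟ j | next i ≟ j | prev i ≟ j
  ... | yes i≡j | _      | _        = cong rim i≡j
  ... | no _    | yes eq | _        = rim j , inj₁ (next⇒Next eq) , refl
  ... | no _    | no _   | yes refl = rim j , inj₂ (next⇒Next (next-prev i)) , refl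
  ... | no _    | no _   | no _     = hub , tt , rim j , tt , refl

  pendantWalk : ∀ i j → VertexWalk (pendantDist i j) (pendant i) (pendant j)
  -- `rimDist i j` itself tests `i ≟ j`; binding the walk in the same `with` rewrites its length
  -- together with the goal.
  pendantWalk i j with i ≟ j | snoc (rimDist i j) (rim i) (rim j) (pendant j) (rimWalk i j) refl
  ... | yes i≡j | _ = cong pendant i≡j
  ... | no _    | w = rim i , refl , w

  helmWalk : ∀ a b → VertexWalk (helmDist a b) a b
  helmWalk hub         hub         = refl
  helmWalk hub         (rim j)     = rim j , tt , refl
  helmWalk hub         (pendant j) = rim j , tt , pendant j , refl , refl
  helmWalk (rim i)     hub         = hub , tt , refl
  helmWalk (rim i)     (rim j)     = rimWalk i j
  helmWalk (rim i)     (pendant j) = snoc (rimDist i j) (rim i) (rim j) (pendant j) (rimWalk i j) refl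
  helmWalk (pendant i) hub         = rim i , refl , hub , tt , refl
  helmWalk (pendant i) (rim j)     = rim i , refl , rimWalk i j
  helmWalk (pendant i) (pendant j) = pendantWalk i j

  -- Ensures that the search, whose fuel is the number 1 + 2r of vertices, reaches the distance.
  helmDist≤4 : ∀ a b → helmDist a b ≤ 4
  helmDist≤4 hub         hub         = z≤n
  helmDist≤4 hub         (rim _)     = s≤s z≤n
  helmDist≤4 hub         (pendant _) = s≤s (s≤s z≤n)
  helmDist≤4 (rim _)     hub         = s≤s z≤n
  helmDist≤4 (rim i)     (rim j)     = ℕ.≤-trans (rimDist≤2 i j) (ℕ.m≤m+n 2 2)
  helmDist≤4 (rim i)     (pendant j) = ℕ.≤-trans (s≤s (rimDist≤2 i j)) (ℕ.m≤m+n 3 1)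
  helmDist≤4 (pendant _) hub         = s≤s (s≤s z≤n)
  helmDist≤4 (pendant i) (rim j)     = ℕ.≤-trans (s≤s (rimDist≤2 i j)) (ℕ.m≤m+n 3 1)
  helmDist≤4 (pendant i) (pendant j) = ℕ.≤-trans (pendantDist≤ i j) (s≤s (s≤s (rimDist≤2 i j)))

  _~_ : Rel (Fin (order r)) 0ℓ
  u ~ v = Adjacent (vertex u) (vertex v)

  _~?_ : Decidable _~_
  u ~? v = adjacent? (vertex u) (vertex v)

  open Distance _~?_

  fromVertexWalk : ∀ k u v → VertexWalk k (vertex u) (vertex v) → Walk k u v
  fromVertexWalk zero    u v eq            = vertex-injective {r} eq
  fromVertexWalk (suc k) u v (c , u~c , w) =
    index c ,
    subst (Adjacent (vertex u)) (≡.sym (vertex-index c)) u~c ,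
    fromVertexWalk k (index c) v (subst (λ d → VertexWalk k d (vertex v)) (≡.sym (vertex-index c)) w)

  helmDist-least : ∀ k u v → Walk k u v → helmDist (vertex u) (vertex v) ≤ k
  helmDist-least zero    u u refl          = ℕ.≤-reflexive (helmDist-refl (vertex u))
  helmDist-least (suc k) u v (l , u~l , w) =
    ℕ.≤-trans (helmDist-lipschitz (vertex u) (vertex l) (vertex v) u~l) (s≤s (helmDist-least k l v w))

  dist≡helmDist : ∀ u v → dist u v ≡ helmDist (vertex u) (vertex v)
  dist≡helmDist u v = dist-least _~?_
    (fromVertexWalk _ u v (helmWalk (vertex u) (vertex v)))
    (λ k → helmDist-least k u v)
    (ℕ.≤-trans (helmDist≤4 (vertex u) (vertex v))
               (s≤s (ℕ.≤-trans (s≤s 2≤p) (ℕ.m≤m+n r r))))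

  -- On a rim of at least three vertices i, `next i` and `prev i` are distinct, so at most one
  -- indicator in `S i j` is nonzero.
  fromℕ-rimDist : ∀ i j → fromℕ (rimDist i j) ≡ fromℕ 2 - S i j
  fromℕ-rimDist i j with i ≟ j | next i ≟ j | prev i ≟ j
  ... | yes i≡j | yes eq | _      = contradiction (trans eq (≡.sym i≡j)) (next≢id (ℕ.<⇒≤ 2≤p) i)
  ... | yes i≡j | no _   | yes eq = contradiction (trans eq (≡.sym i≡j)) (prev≢id (ℕ.<⇒≤ 2≤p) i)
  ... | yes _   | no _   | no _   = refl
  ... | no _    | yes e  | yes e′ = contradiction (trans e (≡.sym e′)) (next≢prev 2≤p i)
  ... | no _    | yes _  | no _   = refl
  ... | no _    | no _   | yes _  = refl
  ... | no _    | no _   | no _   = refl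

  fromℕ-pendantDist : ∀ i j → fromℕ (pendantDist i j) ≡ fromℕ 4 - S i j - fromℕ 2 * identity i j
  fromℕ-pendantDist i j = begin
    fromℕ (pendantDist i j)
      ≡⟨ step (rimDist i j) (λ { refl → rimDist-refl i }) ⟩
    fromℕ 2 + fromℕ (rimDist i j) - fromℕ 2 * identity i j
      ≡⟨ cong (λ q → fromℕ 2 + q - fromℕ 2 * identity i j) (fromℕ-rimDist i j) ⟩
    fromℕ 2 + (fromℕ 2 - S i j) - fromℕ 2 * identity i j
      ≡⟨ lemma (S i j) (identity i j) ⟩
    fromℕ 4 - S i j - fromℕ 2 * identity i j ∎
    where
    lemma : ∀ s d → fromℕ 2 + (fromℕ 2 - s) - fromℕ 2 * d ≡ fromℕ 4 - s - fromℕ 2 * d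
    lemma = solve-∀ ring
    -- The variable k shields `rimDist i j` from the case split on `i ≟ j`.
    step : ∀ k → (i ≡ j → k ≡ 0) → fromℕ (if does (i ≟ j) then 0 else 2 ℕ.+ k) ≡
                                   fromℕ 2 + fromℕ k - fromℕ 2 * identity i j
    step k i≡j⇒k≡0 with i ≟ j
    ... | yes i≡j = cong (λ l → fromℕ 2 + fromℕ l - fromℕ 2 * 1ℚ) (≡.sym (i≡j⇒k≡0 i≡j))
    ... | no _    = trans (fromℕ-+ 2 k) (≡.sym (ℚ.+-identityʳ (fromℕ 2 + fromℕ k)))

-- The blocks of D, L and w

suc-odd⇒even : ∀ k → suc k % 2 ≡ 1 → k ≡ k ℕ./ 2 ℕ.+ k ℕ./ 2
suc-odd⇒even k odd = begin
  k                              ≡⟨ m≡m%n+[m/n]*n k 2 ⟩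
  k % 2 ℕ.+ k ℕ./ 2 ℕ.* 2        ≡⟨ cong (ℕ._+ k ℕ./ 2 ℕ.* 2)
      (even (k % 2) (m%n<n k 2) (trans (≡.sym (%-distribˡ-+ 1 k 2)) odd)) ⟩
  k ℕ./ 2 ℕ.* 2                  ≡⟨ ℕ.*-comm (k ℕ./ 2) 2 ⟩
  k ℕ./ 2 ℕ.+ (k ℕ./ 2 ℕ.+ 0)    ≡⟨ cong (k ℕ./ 2 ℕ.+_) (ℕ.+-identityʳ (k ℕ./ 2)) ⟩
  k ℕ./ 2 ℕ.+ k ℕ./ 2            ∎
  where
  even : ∀ l → l < 2 → suc l % 2 ≡ 1 → l ≡ 0
  even 0 _ _ = refl
  even 1 _ ()
  even (suc (suc _)) (s≤s (s≤s ())) _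

module HelmInverse (p : ℕ) (5≤n : 5 ≤ suc (suc p)) (odd : suc (suc p) % 2 ≡ 1) where
  open Helm (suc (suc p)) 5≤n using (m; α; x-numerator; y-numerator; A; B; D; L-entry; L; w-numerator; w)
  private
    r n : ℕ
    r = suc p
    n = suc r

    R M : ℚ
    R = fromℕ r
    M = fromℕ m

    2≤p : 2 ≤ p
    2≤p = ℕ.≤-trans (ℕ.m≤n+m 2 1) (ℕ.s≤s⁻¹ (ℕ.s≤s⁻¹ 5≤n))

    r≡m+m : r ≡ m ℕ.+ m
    r≡m+m = suc-odd⇒even r odd

  open Cycle p
  open CycleMatrices p m r≡m+m
  open HelmDistance p 2≤p hiding (_~_; _~?_)

  -- Closed forms of the circulants A and B

  c q : ℚ
  c = 1ℤ / r
  q = 1ℤ / (6 ℕ.* r)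

  c*R≡1 : c * R ≡ 1ℚ
  c*R≡1 = /-*-cancel 1ℤ r

  q*6R≡1 : q * (fromℕ 6 * R) ≡ 1ℚ
  q*6R≡1 = trans (cong (λ d → q * d) (≡.sym (fromℕ-* 6 r))) (/-*-cancel 1ℤ (6 ℕ.* r))

  6q≡c : fromℕ 6 * q ≡ c
  6q≡c = begin
    fromℕ 6 * q                ≡⟨ ℚ.*-identityʳ (fromℕ 6 * q) ⟨
    fromℕ 6 * q * 1ℚ           ≡⟨ cong (λ s → fromℕ 6 * q * s) c*R≡1 ⟨
    fromℕ 6 * q * (c * R)      ≡⟨ lemma q c R ⟩
    q * (fromℕ 6 * R) * c      ≡⟨ cong (_* c) q*6R≡1 ⟩
    1ℚ * c                     ≡⟨ ℚ.*-identityˡ c ⟩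
    c                          ∎
    where
    lemma : ∀ q c R → fromℕ 6 * q * (c * R) ≡ q * (fromℕ 6 * R) * c
    lemma = solve-∀ ring

  fromℤ-α : ∀ k → fromℤ (α k) ≡ - (ε k * β M (fromℕ k))
  fromℤ-α k = begin
    fromℤ (α k)
      ≡⟨ fromℤ-* (-1ℤ ℤ.^ (k ℕ.+ 1)) _ ⟩
    fromℤ (-1ℤ ℤ.^ (k ℕ.+ 1)) * fromℤ (+ 2 ℤ.* (+ m) ℤ.^ 2 ℤ.- + 6 ℤ.* (+ m ℤ.- + k) ℤ.^ 2 ℤ.+ + 7)
      ≡⟨ cong₂ _*_ (trans (fromℤ-ε (k ℕ.+ 1)) (ε-+ k 1)) bracket ⟩
    ε k * - 1ℚ * (fromℕ 2 * (M * M) - fromℕ 6 * ((M - fromℕ k) * (M - fromℕ k)) + fromℕ 7)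
      ≡⟨ β-vertexForm (ε k) M (fromℕ k) ⟩
    - (ε k * β M (fromℕ k)) ∎
    where
    bracket : fromℤ (+ 2 ℤ.* (+ m) ℤ.^ 2 ℤ.- + 6 ℤ.* (+ m ℤ.- + k) ℤ.^ 2 ℤ.+ + 7) ≡
              fromℕ 2 * (M * M) - fromℕ 6 * ((M - fromℕ k) * (M - fromℕ k)) + fromℕ 7
    bracket = trans
      (fromℤ-+ (+ 2 ℤ.* (+ m) ℤ.^ 2 ℤ.- + 6 ℤ.* (+ m ℤ.- + k) ℤ.^ 2) (+ 7))
      (cong (_+ fromℕ 7) (trans
        (fromℤ-- (+ 2 ℤ.* (+ m) ℤ.^ 2) (+ 6 ℤ.* (+ m ℤ.- + k) ℤ.^ 2))
        (cong₂ _-_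
          (trans (fromℤ-* (+ 2) ((+ m) ℤ.^ 2)) (cong (λ s → fromℕ 2 * s) (fromℤ-^2 (+ m))))
          (trans (fromℤ-* (+ 6) ((+ m ℤ.- + k) ℤ.^ 2)) (cong (λ s → fromℕ 6 * s)
            (trans (fromℤ-^2 (+ m ℤ.- + k)) (cong₂ _*_ (fromℤ-- (+ m) (+ k)) (fromℤ-- (+ m) (+ k)))))))))

  -- Sign and quadratic are both invariant under k ↦ r - k, which undoes the folding by the minimum;
  -- the delta absorbs the first entry.
  fromℤ-x-numerator : ∀ {k} → k < r →
    fromℤ (x-numerator k) ≡ fromℕ 6 * R * δ 0 k - ε k * β M (fromℕ k)
  fromℤ-x-numerator {zero}  _   = begin
    fromℤ ((+ n) ℤ.^ 2 ℤ.+ + 4 ℤ.* + n ℤ.- + 12)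
      ≡⟨ trans (fromℤ-- ((+ n) ℤ.^ 2 ℤ.+ + 4 ℤ.* + n) (+ 12))
          (cong (_- fromℕ 12) (trans (fromℤ-+ ((+ n) ℤ.^ 2) (+ 4 ℤ.* + n))
            (cong₂ _+_ (fromℤ-^2 (+ n)) (fromℤ-* (+ 4) (+ n))))) ⟩
    fromℕ n * fromℕ n + fromℕ 4 * fromℕ n - fromℕ 12
      ≡⟨ cong (λ s → s * s + fromℕ 4 * s - fromℕ 12)
          (trans (fromℕ-suc r) (cong (λ s → 1ℚ + s) (fromℕ-r m r≡m+m))) ⟩
    (1ℚ + (M + M)) * (1ℚ + (M + M)) + fromℕ 4 * (1ℚ + (M + M)) - fromℕ 12
      ≡⟨ β-diagonal M ⟩
    fromℕ 6 * (M + M) * 1ℚ - 1ℚ * β M 0ℚ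
      ≡⟨ cong (λ s → fromℕ 6 * s * 1ℚ - 1ℚ * β M 0ℚ) (fromℕ-r m r≡m+m) ⟨
    fromℕ 6 * R * 1ℚ - 1ℚ * β M 0ℚ ∎
  fromℤ-x-numerator {k@(suc _)} k<r = begin
    fromℤ (α (k ⊓ (r ∸ k)))                      ≡⟨ fromℤ-α (k ⊓ (r ∸ k)) ⟩
    - φ (k ⊓ (r ∸ k))                            ≡⟨ cong -_ (go (ℕ.⊓-sel k (r ∸ k))) ⟩
    - φ k                                        ≡⟨ lemma R (φ k) ⟩
    fromℕ 6 * R * 0ℚ - φ k                       ∎
    where
    φ : ℕ → ℚ
    φ k = ε k * β M (fromℕ k)
    k≤r : k ≤ r
    k≤r = ℕ.<⇒≤ k<r
    go : k ⊓ (r ∸ k) ≡ k ⊎ k ⊓ (r ∸ k) ≡ r ∸ k → φ (k ⊓ (r ∸ k)) ≡ φ k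
    go (inj₁ eq) = cong φ eq
    go (inj₂ eq) = trans (cong φ eq) (cong₂ _*_ (ε-∸ m r≡m+m k≤r) (β-∸ m r≡m+m k≤r))
    lemma : ∀ R s → - s ≡ fromℕ 6 * R * 0ℚ - s
    lemma = solve-∀ ring

  -- The first entry 2 - n is 1 - r, the alternating value lowered by r; scaled by 1/r, this becomes
  -- -I in `B`.
  fromℤ-y-numerator : ∀ k → fromℤ (y-numerator k) ≡ ε k - R * δ 0 k
  fromℤ-y-numerator zero    = begin
    fromℤ (+ 2 ℤ.- + n)          ≡⟨ fromℤ-- (+ 2) (+ n) ⟩
    fromℕ 2 - fromℕ n            ≡⟨ cong (λ s → fromℕ 2 - s) (fromℕ-suc r) ⟩
    fromℕ 2 - (1ℚ + R)           ≡⟨ lemma R ⟩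
    1ℚ - R * 1ℚ                  ∎
    where
    lemma : ∀ R → fromℕ 2 - (1ℚ + R) ≡ 1ℚ - R * 1ℚ
    lemma = solve-∀ ring
  fromℤ-y-numerator (suc k) = trans (fromℤ-ε (suc k)) (lemma (ε (suc k)) R)
    where
    lemma : ∀ e R → e ≡ e - R * 0ℚ
    lemma = solve-∀ ring

  δ-interior : ∀ {k} → 0 < k → k < r → δ 0 (r ∸ k) ≡ δ 0 k
  δ-interior {k@(suc _)} _ k<r with r ∸ k | ℕ.m<n⇒0<n∸m k<r
  ... | suc _ | _ = refl

  A≡ : ∀ i j → A i j ≡ identity i j - q * Kᶠ i j
  A≡ i j = begin
    A i j
      ≡⟨ Circ-even (λ k → q * fromℤ (x-numerator k)) (λ 0<k k<r → cong (λ s → q * s) (x-even 0<k k<r)) i j ⟩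
    q * fromℤ (x-numerator ∣ toℕ i - toℕ j ∣)
      ≡⟨ cong (λ s → q * s) (fromℤ-x-numerator d<r) ⟩
    q * (fromℕ 6 * R * δ 0 ∣ toℕ i - toℕ j ∣ - ε ∣ toℕ i - toℕ j ∣ * b)
      ≡⟨ cong₂ (λ s t → q * (fromℕ 6 * R * s - t * b))
          (trans (δ-∣-∣ (toℕ i) (toℕ j)) (δ-identity i j)) (ε-∣-∣ (toℕ i) (toℕ j)) ⟩
    q * (fromℕ 6 * R * identity i j - εᶠ i * εᶠ j * b)
      ≡⟨ lemma q R (identity i j) (Kᶠ i j) ⟩
    q * (fromℕ 6 * R) * identity i j - q * Kᶠ i j
      ≡⟨ cong (λ s → s * identity i j - q * Kᶠ i j) q*6R≡1 ⟩
    1ℚ * identity i j - q * Kᶠ i j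
      ≡⟨ cong (_- q * Kᶠ i j) (ℚ.*-identityˡ (identity i j)) ⟩
    identity i j - q * Kᶠ i j ∎
    where
    b : ℚ
    b = β M (fromℕ ∣ toℕ i - toℕ j ∣)
    d<r : ∣ toℕ i - toℕ j ∣ < r
    d<r = ℕ.≤-<-trans (ℕ.∣m-n∣≤m⊔n (toℕ i) (toℕ j)) (ℕ.⊔-lub (Fin.toℕ<n i) (Fin.toℕ<n j))
    x-even : ∀ {k} → 0 < k → k < r → fromℤ (x-numerator (r ∸ k)) ≡ fromℤ (x-numerator k)
    x-even {k} 0<k k<r = begin
      fromℤ (x-numerator (r ∸ k))
        ≡⟨ fromℤ-x-numerator (ℕ.∸-monoʳ-< 0<k (ℕ.<⇒≤ k<r)) ⟩
      fromℕ 6 * R * δ 0 (r ∸ k) - ε (r ∸ k) * β M (fromℕ (r ∸ k))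
        ≡⟨ cong₂ (λ s t → fromℕ 6 * R * s - t) (δ-interior 0<k k<r)
            (cong₂ _*_ (ε-∸ m r≡m+m (ℕ.<⇒≤ k<r)) (β-∸ m r≡m+m (ℕ.<⇒≤ k<r))) ⟩
      fromℕ 6 * R * δ 0 k - ε k * β M (fromℕ k)
        ≡⟨ fromℤ-x-numerator k<r ⟨
      fromℤ (x-numerator k) ∎
    lemma : ∀ q R d k → q * (fromℕ 6 * R * d - k) ≡ q * (fromℕ 6 * R) * d - q * k
    lemma = solve-∀ ring

  B≡ : ∀ i j → B i j ≡ c * (εᶠ i * εᶠ j) - identity i j
  B≡ i j = begin
    B i j
      ≡⟨ Circ-even (λ k → c * fromℤ (y-numerator k)) (λ 0<k k<r → cong (λ s → c * s) (y-even 0<k k<r)) i j ⟩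
    c * fromℤ (y-numerator ∣ toℕ i - toℕ j ∣)
      ≡⟨ cong (λ s → c * s) (fromℤ-y-numerator ∣ toℕ i - toℕ j ∣) ⟩
    c * (ε ∣ toℕ i - toℕ j ∣ - R * δ 0 ∣ toℕ i - toℕ j ∣)
      ≡⟨ cong₂ (λ s t → c * (t - R * s)) (trans (δ-∣-∣ (toℕ i) (toℕ j)) (δ-identity i j))
          (ε-∣-∣ (toℕ i) (toℕ j)) ⟩
    c * (εᶠ i * εᶠ j - R * identity i j)
      ≡⟨ lemma c R (identity i j) (εᶠ i * εᶠ j) ⟩
    c * (εᶠ i * εᶠ j) - c * R * identity i j
      ≡⟨ cong (λ s → c * (εᶠ i * εᶠ j) - s * identity i j) c*R≡1 ⟩
    c * (εᶠ i * εᶠ j) - 1ℚ * identity i j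
      ≡⟨ cong (λ s → c * (εᶠ i * εᶠ j) - s) (ℚ.*-identityˡ (identity i j)) ⟩
    c * (εᶠ i * εᶠ j) - identity i j ∎
    where
    y-even : ∀ {k} → 0 < k → k < r → fromℤ (y-numerator (r ∸ k)) ≡ fromℤ (y-numerator k)
    y-even {k} 0<k k<r = trans (fromℤ-y-numerator (r ∸ k)) (trans
      (cong₂ (λ s t → s - R * t) (ε-∸ m r≡m+m (ℕ.<⇒≤ k<r)) (δ-interior 0<k k<r))
      (≡.sym (fromℤ-y-numerator k)))
    lemma : ∀ c R d e → c * (e - R * d) ≡ c * e - c * R * d
    lemma = solve-∀ ring

  A-sym : ∀ i j → A i j ≡ A j i
  A-sym i j = trans (A≡ i j) (trans
    (cong₂ (λ s t → s - q * t) (identity-sym i j) (K-sym m (toℕ i) (toℕ j)))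
    (≡.sym (A≡ j i)))

  B-sym : ∀ i j → B i j ≡ B j i
  B-sym i j = trans (B≡ i j) (trans
    (cong₂ (λ s t → c * s - t) (ℚ.*-comm (εᶠ i) (εᶠ j)) (identity-sym i j))
    (≡.sym (B≡ j i)))

  -- The identity gives 1, and the total -3R of a column of `K`, scaled by -1/(6r), gives ½.
  sum-A : ∀ j → sum (λ k → A k j) ≡ 1ℚ + ½
  sum-A j = begin
    sum (λ k → A k j)
      ≡⟨ sum-cong-≗ (λ k → trans (A≡ k j) (lemma (identity k j) q (Kᶠ k j))) ⟩
    sum (λ k → 1ℚ * identity k j + - q * Kᶠ k j)
      ≡⟨ sum-linear 1ℚ (- q) (λ k → identity k j) (λ k → Kᶠ k j) ⟩
    1ℚ * sum (λ k → identity k j) + - q * sum (λ k → Kᶠ k j)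
      ≡⟨ cong₂ (λ s t → 1ℚ * s + - q * t) (sum-identity-column j) (sum-K j) ⟩
    1ℚ * 1ℚ + - q * - (fromℕ 3 * R)
      ≡⟨ lemma₂ q R ⟩
    1ℚ + ½ * (q * (fromℕ 6 * R))
      ≡⟨ cong (λ s → 1ℚ + ½ * s) q*6R≡1 ⟩
    1ℚ + ½ ∎
    where
    lemma : ∀ d q k → d - q * k ≡ 1ℚ * d + - q * k
    lemma = solve-∀ ring
    lemma₂ : ∀ q R → 1ℚ * 1ℚ + - q * - (fromℕ 3 * R) ≡ 1ℚ + ½ * (q * (fromℕ 6 * R))
    lemma₂ = solve-∀ ring

  sum-B : ∀ j → sum (λ k → B k j) ≡ - 1ℚ
  sum-B j = begin
    sum (λ k → B k j)
      ≡⟨ sum-cong-≗ (λ k → trans (B≡ k j) (lemma (identity k j) c (εᶠ k) (εᶠ j))) ⟩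
    sum (λ k → c * εᶠ j * εᶠ k + - 1ℚ * identity k j)
      ≡⟨ sum-linear (c * εᶠ j) (- 1ℚ) εᶠ (λ k → identity k j) ⟩
    c * εᶠ j * sum εᶠ + - 1ℚ * sum (λ k → identity k j)
      ≡⟨ cong₂ (λ s t → c * εᶠ j * s + - 1ℚ * t) sum-ε (sum-identity-column j) ⟩
    c * εᶠ j * 0ℚ + - 1ℚ * 1ℚ
      ≡⟨ cong (_+ - 1ℚ * 1ℚ) (ℚ.*-zeroʳ (c * εᶠ j)) ⟩
    - 1ℚ ∎
    where
    lemma : ∀ i c d e → c * (d * e) - i ≡ c * e * d + - 1ℚ * i
    lemma = solve-∀ ring

  -- The alternating vector is an eigenvector of `K` for the eigenvalue 6R, of which q is the
  -- inverse.
  sum-ε-A : ∀ j → sum (λ k → εᶠ k * A k j) ≡ 0ℚ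
  sum-ε-A j = begin
    sum (λ k → εᶠ k * A k j)
      ≡⟨ sum-cong-≗ (λ k → trans (cong (λ s → εᶠ k * s) (A≡ k j)) (lemma (εᶠ k) (identity k j) q (Kᶠ k j))) ⟩
    sum (λ k → 1ℚ * (identity k j * εᶠ k) + - q * (εᶠ k * Kᶠ k j))
      ≡⟨ sum-linear 1ℚ (- q) (λ k → identity k j * εᶠ k) (λ k → εᶠ k * Kᶠ k j) ⟩
    1ℚ * sum (λ k → identity k j * εᶠ k) + - q * sum (λ k → εᶠ k * Kᶠ k j)
      ≡⟨ cong₂ (λ s t → 1ℚ * s + - q * t) (sum-identityᵀ j εᶠ) (sum-ε-K j) ⟩
    1ℚ * εᶠ j + - q * (fromℕ 6 * R * εᶠ j)
      ≡⟨ lemma₂ q R (εᶠ j) ⟩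
    εᶠ j - q * (fromℕ 6 * R) * εᶠ j
      ≡⟨ cong (λ s → εᶠ j - s * εᶠ j) q*6R≡1 ⟩
    εᶠ j - 1ℚ * εᶠ j
      ≡⟨ lemma₃ (εᶠ j) ⟩
    0ℚ ∎
    where
    lemma : ∀ e d q k → e * (d - q * k) ≡ 1ℚ * (d * e) + - q * (e * k)
    lemma = solve-∀ ring
    lemma₂ : ∀ q R e → 1ℚ * e + - q * (fromℕ 6 * R * e) ≡ e - q * (fromℕ 6 * R) * e
    lemma₂ = solve-∀ ring
    lemma₃ : ∀ e → e - 1ℚ * e ≡ 0ℚ
    lemma₃ = solve-∀ ring

  sum-ε-B : ∀ j → sum (λ k → εᶠ k * B k j) ≡ 0ℚ
  sum-ε-B j = begin
    sum (λ k → εᶠ k * B k j)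
      ≡⟨ sum-cong-≗ (λ k → trans (cong (λ s → εᶠ k * s) (B≡ k j)) (lemma (εᶠ k) (εᶠ j) c (identity k j))) ⟩
    sum (λ k → c * εᶠ j * (εᶠ k * εᶠ k) + - 1ℚ * (identity k j * εᶠ k))
      ≡⟨ sum-linear (c * εᶠ j) (- 1ℚ) (λ k → εᶠ k * εᶠ k) (λ k → identity k j * εᶠ k) ⟩
    c * εᶠ j * sum (λ k → εᶠ k * εᶠ k) + - 1ℚ * sum (λ k → identity k j * εᶠ k)
      ≡⟨ cong₂ (λ s t → c * εᶠ j * s + - 1ℚ * t)
          (trans (sum-cong-≗ {r} (λ k → ε² (toℕ k))) (sum-const r 1ℚ)) (sum-identityᵀ j εᶠ) ⟩
    c * εᶠ j * (R * 1ℚ) + - 1ℚ * εᶠ j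
      ≡⟨ lemma₂ c R (εᶠ j) ⟩
    c * R * εᶠ j - εᶠ j
      ≡⟨ cong (λ s → s * εᶠ j - εᶠ j) c*R≡1 ⟩
    1ℚ * εᶠ j - εᶠ j
      ≡⟨ lemma₃ (εᶠ j) ⟩
    0ℚ ∎
    where
    lemma : ∀ d e c i → d * (c * (d * e) - i) ≡ c * e * (d * d) + - 1ℚ * (i * d)
    lemma = solve-∀ ring
    lemma₂ : ∀ c R e → c * e * (R * 1ℚ) + - 1ℚ * e ≡ c * R * e - e
    lemma₂ = solve-∀ ring
    lemma₃ : ∀ e → 1ℚ * e - e ≡ 0ℚ
    lemma₃ = solve-∀ ring

  -- The identity terms of `A` and `B` cancel; of the rest, `S` kills the multiple of ε and acts on
  -- `K` by `neighbourSum-K`.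
  neighbourSum-A+B : ∀ j i →
    neighbourSum (λ k → A k j + B k j) i ≡ fromℕ 2 * identity i j - fromℕ 2 * (c * (εᶠ i * εᶠ j))
  neighbourSum-A+B j i = begin
    neighbourSum (λ k → A k j + B k j) i
      ≡⟨ neighbourSum-cong (λ k → trans (cong₂ _+_ (A≡ k j) (B≡ k j))
          (lemma (identity k j) q (Kᶠ k j) c (εᶠ k) (εᶠ j))) i ⟩
    neighbourSum (λ k → c * εᶠ j * εᶠ k + - q * Kᶠ k j) i
      ≡⟨ neighbourSum-linear (c * εᶠ j) (- q) εᶠ (λ k → Kᶠ k j) i ⟩
    c * εᶠ j * neighbourSum εᶠ i + - q * neighbourSum (λ k → Kᶠ k j) i
      ≡⟨ cong₂ (λ s t → c * εᶠ j * s + - q * t) (neighbourSum-ε i) (neighbourSum-K i j) ⟩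
    c * εᶠ j * 0ℚ + - q * (fromℕ 12 * (εᶠ i * εᶠ j) - fromℕ 12 * (R * identity i j))
      ≡⟨ lemma₂ (c * εᶠ j) q (εᶠ i * εᶠ j) R (identity i j) ⟩
    fromℕ 2 * (q * (fromℕ 6 * R) * identity i j) - fromℕ 2 * (fromℕ 6 * q * (εᶠ i * εᶠ j))
      ≡⟨ cong₂ (λ s t → fromℕ 2 * (s * identity i j) - fromℕ 2 * (t * (εᶠ i * εᶠ j))) q*6R≡1 6q≡c ⟩
    fromℕ 2 * (1ℚ * identity i j) - fromℕ 2 * (c * (εᶠ i * εᶠ j))
      ≡⟨ cong (λ s → fromℕ 2 * s - fromℕ 2 * (c * (εᶠ i * εᶠ j))) (ℚ.*-identityˡ (identity i j)) ⟩
    fromℕ 2 * identity i j - fromℕ 2 * (c * (εᶠ i * εᶠ j)) ∎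
    where
    lemma : ∀ i q k c d e → i - q * k + (c * (d * e) - i) ≡ c * e * d + - q * k
    lemma = solve-∀ ring
    lemma₂ : ∀ a q e R i → a * 0ℚ + - q * (fromℕ 12 * e - fromℕ 12 * (R * i)) ≡
                           fromℕ 2 * (q * (fromℕ 6 * R) * i) - fromℕ 2 * (fromℕ 6 * q * e)
    lemma₂ = solve-∀ ring

  neighbourSum-B+I : ∀ j i → neighbourSum (λ k → B k j + identity k j) i ≡ 0ℚ
  neighbourSum-B+I j i = begin
    neighbourSum (λ k → B k j + identity k j) i
      ≡⟨ neighbourSum-cong (λ k → trans (cong (_+ identity k j) (B≡ k j))
          (lemma c (εᶠ k) (εᶠ j) (identity k j))) i ⟩
    -- The zero summand brings the vector into the two-term shape of `neighbourSum-linear`.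
    neighbourSum (λ k → c * εᶠ j * εᶠ k + 0ℚ * εᶠ k) i
      ≡⟨ neighbourSum-linear (c * εᶠ j) 0ℚ εᶠ εᶠ i ⟩
    c * εᶠ j * neighbourSum εᶠ i + 0ℚ * neighbourSum εᶠ i
      ≡⟨ cong (λ s → c * εᶠ j * s + 0ℚ * s) (neighbourSum-ε i) ⟩
    c * εᶠ j * 0ℚ + 0ℚ * 0ℚ
      ≡⟨ lemma₂ (c * εᶠ j) ⟩
    0ℚ ∎
    where
    lemma : ∀ c d e i → c * (d * e) - i + i ≡ c * e * d + 0ℚ * d
    lemma = solve-∀ ring
    lemma₂ : ∀ a → a * 0ℚ + 0ℚ * 0ℚ ≡ 0ℚ
    lemma₂ = solve-∀ ring

  neighbourSum-const : ∀ s i → neighbourSum (λ _ → s) i ≡ fromℕ 4 * s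
  neighbourSum-const s i = lemma s
    where
    lemma : ∀ s → fromℕ 2 * s + s + s ≡ fromℕ 4 * s
    lemma = solve-∀ ring

  -- Rows of D applied to a vector

  Dᵛ : Vertex r → Vertex r → ℚ
  Dᵛ a b = fromℕ (helmDist a b)

  D≡Dᵛ : ∀ u v → D u v ≡ Dᵛ (vertex u) (vertex v)
  D≡Dᵛ u v = cong fromℕ (dist≡helmDist u v)

  module _ (f : Vertex r → ℚ) where
    private
      s t : ℚ
      s = sum (f ∘ rim)
      t = sum (f ∘ pendant)
      -- Both blocks of a rim or pendant row subtract `S`, so only the sum of the two parts of `f`
      -- meets it.
      N : Fin r → ℚ
      N = neighbourSum (λ k → f (rim k) + f (pendant k))

      N≡ : ∀ i → neighbourSum (f ∘ rim) i + neighbourSum (f ∘ pendant) i ≡ N i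
      N≡ i = ≡.sym (trans
        (neighbourSum-cong (λ k → lemma (f (rim k)) (f (pendant k))) i)
        (trans (neighbourSum-linear 1ℚ 1ℚ (f ∘ rim) (f ∘ pendant) i)
               (≡.sym (lemma (neighbourSum (f ∘ rim) i) (neighbourSum (f ∘ pendant) i)))))
        where
        lemma : ∀ a b → a + b ≡ 1ℚ * a + 1ℚ * b
        lemma = solve-∀ ring

      rimRow : ∀ i → sum (λ k → fromℕ (rimDist i k) * f (rim k)) ≡ fromℕ 2 * s - neighbourSum (f ∘ rim) i
      rimRow i = trans (sum-cong-≗ (λ k → cong (_* f (rim k)) (fromℕ-rimDist i k)))
                       (sum-const-S (fromℕ 2) i (f ∘ rim))

      suc-rimRow : ∀ (g : Fin r → ℚ) i → sum (λ k → fromℕ (suc (rimDist i k)) * g k) ≡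
          fromℕ 3 * sum g - neighbourSum g i
      suc-rimRow g i = trans
        (sum-cong-≗ (λ k → cong (_* g k) (trans (fromℕ-suc (rimDist i k))
          (trans (cong (λ x → 1ℚ + x) (fromℕ-rimDist i k)) (lemma (S i k))))))
        (sum-const-S (fromℕ 3) i g)
        where
        lemma : ∀ x → 1ℚ + (fromℕ 2 - x) ≡ fromℕ 3 - x
        lemma = solve-∀ ring

      pendantRow : ∀ i → sum (λ k → fromℕ (pendantDist i k) * f (pendant k)) ≡
                         fromℕ 4 * t - neighbourSum (f ∘ pendant) i - fromℕ 2 * f (pendant i)
      pendantRow i = begin
        sum (λ k → fromℕ (pendantDist i k) * f (pendant k))
          ≡⟨ sum-cong-≗ (λ k → trans (cong (_* f (pendant k)) (fromℕ-pendantDist i k))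
              (lemma (S i k) (identity i k) (f (pendant k)))) ⟩
        sum (λ k → 1ℚ * ((fromℕ 4 - S i k) * f (pendant k)) + - fromℕ 2 * (identity i k * f (pendant k)))
          ≡⟨ sum-linear 1ℚ (- fromℕ 2) (λ k → (fromℕ 4 - S i k) * f (pendant k))
              (λ k → identity i k * f (pendant k)) ⟩
        1ℚ * sum (λ k → (fromℕ 4 - S i k) * f (pendant k)) + - fromℕ 2 * sum
            (λ k → identity i k * f (pendant k))
          ≡⟨ cong₂ (λ x y → 1ℚ * x + - fromℕ 2 * y) (sum-const-S (fromℕ 4) i (f ∘ pendant))
              (sum-identity i (f ∘ pendant)) ⟩
        1ℚ * (fromℕ 4 * t - neighbourSum (f ∘ pendant) i) + - fromℕ 2 * f (pendant i)
          ≡⟨ lemma₂ (fromℕ 4 * t - neighbourSum (f ∘ pendant) i) (f (pendant i)) ⟩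
        fromℕ 4 * t - neighbourSum (f ∘ pendant) i - fromℕ 2 * f (pendant i) ∎
        where
        lemma : ∀ x d y → (fromℕ 4 - x - fromℕ 2 * d) * y ≡ 1ℚ * ((fromℕ 4 - x) * y) + - fromℕ 2 * (d * y)
        lemma = solve-∀ ring
        lemma₂ : ∀ a b → 1ℚ * a + - fromℕ 2 * b ≡ a - fromℕ 2 * b
        lemma₂ = solve-∀ ring

    -- Here and in the next two lemmas the totals enter through equations, so that a caller supplies
    -- closed values and is left with a ring identity.
    D-hub : ∀ {s t} → sum (f ∘ rim) ≡ s → sum (f ∘ pendant) ≡ t →
            sumᵛ (λ b → Dᵛ hub b * f b) ≡ s + fromℕ 2 * t
    D-hub refl refl = begin
      0ℚ * f hub + (sum (λ k → 1ℚ * f (rim k)) + sum (λ k → fromℕ 2 * f (pendant k)))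
        ≡⟨ cong₂ (λ x y → 0ℚ * f hub + (x + y)) (*-distribˡ-sum 1ℚ (f ∘ rim))
            (*-distribˡ-sum (fromℕ 2) (f ∘ pendant)) ⟨
      0ℚ * f hub + (1ℚ * s + fromℕ 2 * t)
        ≡⟨ lemma (f hub) s t ⟩
      s + fromℕ 2 * t ∎
      where
      lemma : ∀ h s t → 0ℚ * h + (1ℚ * s + fromℕ 2 * t) ≡ s + fromℕ 2 * t
      lemma = solve-∀ ring

    D-rim : ∀ i {h s t x} → f hub ≡ h → sum (f ∘ rim) ≡ s → sum (f ∘ pendant) ≡ t →
            neighbourSum (λ k → f (rim k) + f (pendant k)) i ≡ x →
            sumᵛ (λ b → Dᵛ (rim i) b * f b) ≡ h + fromℕ 2 * s + fromℕ 3 * t - x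
    D-rim i refl refl refl refl = begin
      1ℚ * f hub + (sum (λ k → fromℕ (rimDist i k) * f (rim k)) + sum
          (λ k → fromℕ (suc (rimDist i k)) * f (pendant k)))
        ≡⟨ cong₂ (λ x y → 1ℚ * f hub + (x + y)) (rimRow i) (suc-rimRow (f ∘ pendant) i) ⟩
      1ℚ * f hub + (fromℕ 2 * s - neighbourSum (f ∘ rim) i + (fromℕ 3 * t - neighbourSum (f ∘ pendant) i))
        ≡⟨ lemma (f hub) s t (neighbourSum (f ∘ rim) i) (neighbourSum (f ∘ pendant) i) ⟩
      f hub + fromℕ 2 * s + fromℕ 3 * t - (neighbourSum (f ∘ rim) i + neighbourSum (f ∘ pendant) i)
        ≡⟨ cong (λ x → f hub + fromℕ 2 * s + fromℕ 3 * t - x) (N≡ i) ⟩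
      f hub + fromℕ 2 * s + fromℕ 3 * t - N i ∎
      where
      lemma : ∀ h s t x y → 1ℚ * h + (fromℕ 2 * s - x + (fromℕ 3 * t - y)) ≡
          h + fromℕ 2 * s + fromℕ 3 * t - (x + y)
      lemma = solve-∀ ring

    D-pendant : ∀ i {h s t x y} → f hub ≡ h → sum (f ∘ rim) ≡ s → sum (f ∘ pendant) ≡ t →
                neighbourSum (λ k → f (rim k) + f (pendant k)) i ≡ x → f (pendant i) ≡ y →
                sumᵛ (λ b → Dᵛ (pendant i) b * f b) ≡ fromℕ 2 * h + fromℕ 3 * s + fromℕ 4 * t - x - fromℕ 2 * y
    D-pendant i refl refl refl refl refl = begin
      fromℕ 2 * f hub + (sum (λ k → fromℕ (suc (rimDist i k)) * f (rim k)) + sum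
          (λ k → fromℕ (pendantDist i k) * f (pendant k)))
        ≡⟨ cong₂ (λ x y → fromℕ 2 * f hub + (x + y)) (suc-rimRow (f ∘ rim) i) (pendantRow i) ⟩
      fromℕ 2 * f hub + (fromℕ 3 * s - neighbourSum (f ∘ rim) i +
          (fromℕ 4 * t - neighbourSum (f ∘ pendant) i - fromℕ 2 * f (pendant i)))
        ≡⟨ lemma (f hub) s t (neighbourSum (f ∘ rim) i) (neighbourSum (f ∘ pendant) i) (f (pendant i)) ⟩
      fromℕ 2 * f hub + fromℕ 3 * s + fromℕ 4 * t -
          (neighbourSum (f ∘ rim) i + neighbourSum (f ∘ pendant) i) - fromℕ 2 * f (pendant i)
        ≡⟨ cong (λ x → fromℕ 2 * f hub + fromℕ 3 * s + fromℕ 4 * t - x - fromℕ 2 * f (pendant i)) (N≡ i) ⟩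
      fromℕ 2 * f hub + fromℕ 3 * s + fromℕ 4 * t - N i - fromℕ 2 * f (pendant i) ∎
      where
      lemma : ∀ h s t x y p → fromℕ 2 * h + (fromℕ 3 * s - x + (fromℕ 4 * t - y - fromℕ 2 * p)) ≡
                              fromℕ 2 * h + fromℕ 3 * s + fromℕ 4 * t - (x + y) - fromℕ 2 * p
      lemma = solve-∀ ring

  -- The products of D with w, L and z

  wᵛ zᵛ : Vertex r → ℚ
  wᵛ a = (1ℤ / 4) * fromℤ (w-numerator a)

  zᵛ hub         = 0ℚ
  zᵛ (rim i)     = εᶠ i
  zᵛ (pendant _) = 0ℚ

  Pᵛ : Vertex r → Vertex r → ℚ
  Pᵛ a b = identityᵛ a b - c * (zᵛ a * zᵛ b)

  w-hub : wᵛ hub ≡ 1ℤ / 4 * (fromℕ 4 - R)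
  w-hub = cong (λ s → 1ℤ / 4 * s) (trans (fromℤ-- (+ 5) (+ n))
    (trans (cong (λ s → fromℕ 5 - s) (fromℕ-suc r)) (lemma R)))
    where
    lemma : ∀ R → fromℕ 5 - (1ℚ + R) ≡ fromℕ 4 - R
    lemma = solve-∀ ring

  L-hub : L-entry hub hub ≡ ½ * R
  L-hub = begin
    h                       ≡⟨ lemma h ⟩
    ½ * (h * fromℕ 2)       ≡⟨ cong (λ s → ½ * s) (/-*-cancel (+ n ℤ.- 1ℤ) 2) ⟩
    ½ * R                   ∎
    where
    h : ℚ
    h = L-entry hub hub
    lemma : ∀ h → h ≡ ½ * (h * fromℕ 2)
    lemma = solve-∀ ring

  w₁ w₂ : ℚ
  w₁ = 1ℤ / 4 * fromℤ -1ℤ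
  w₂ = 1ℤ / 4 * fromℕ 2

  Dw : ∀ a → sumᵛ (λ b → Dᵛ a b * wᵛ b) ≡ + 3 / 4 * R
  Dw hub         = trans (D-hub wᵛ (sum-const r w₁) (sum-const r w₂)) (lemma R)
    where
    lemma : ∀ R → R * w₁ + fromℕ 2 * (R * w₂) ≡ + 3 / 4 * R
    lemma = solve-∀ ring
  Dw (rim i)     = trans
    (D-rim wᵛ i w-hub (sum-const r w₁) (sum-const r w₂) (neighbourSum-const (w₁ + w₂) i)) (lemma R)
    where
    lemma : ∀ R → 1ℤ / 4 * (fromℕ 4 - R) + fromℕ 2 * (R * w₁) + fromℕ 3 * (R * w₂) - fromℕ 4 *
        (w₁ + w₂) ≡ + 3 / 4 * R
    lemma = solve-∀ ring
  Dw (pendant i) = trans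
    (D-pendant wᵛ i w-hub (sum-const r w₁) (sum-const r w₂) (neighbourSum-const (w₁ + w₂) i) refl) (lemma R)
    where
    lemma : ∀ R → fromℕ 2 * (1ℤ / 4 * (fromℕ 4 - R)) + fromℕ 3 * (R * w₁) + fromℕ 4 * (R * w₂) -
                  fromℕ 4 * (w₁ + w₂) - fromℕ 2 * w₂ ≡ + 3 / 4 * R
    lemma = solve-∀ ring

  DL : ∀ a v → sumᵛ (λ b → Dᵛ a b * L-entry b v) ≡ fromℕ 2 * wᵛ v - fromℕ 2 * Pᵛ a v
  DL a hub = trans (row a) (cong (λ s → fromℕ 2 * s - fromℕ 2 * Pᵛ a hub) (≡.sym w-hub))
    where
    row : ∀ a → sumᵛ (λ b → Dᵛ a b * L-entry b hub) ≡ fromℕ 2 * (1ℤ / 4 * (fromℕ 4 - R)) - fromℕ 2 * Pᵛ a hub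
    row hub         = trans (D-hub (λ b → L-entry b hub) (sum-const r -½) (sum-const r 0ℚ)) (lemma R c)
      where
      lemma : ∀ R c → R * -½ + fromℕ 2 * (R * 0ℚ) ≡
              fromℕ 2 * (1ℤ / 4 * (fromℕ 4 - R)) - fromℕ 2 * (1ℚ - c * (0ℚ * 0ℚ))
      lemma = solve-∀ ring
    row (rim i)     = trans
      (D-rim (λ b → L-entry b hub) i L-hub (sum-const r -½) (sum-const r 0ℚ) (neighbourSum-const (-½ + 0ℚ) i))
      (lemma R c (εᶠ i))
      where
      lemma : ∀ R c e → ½ * R + fromℕ 2 * (R * -½) + fromℕ 3 * (R * 0ℚ) - fromℕ 4 * (-½ + 0ℚ) ≡
              fromℕ 2 * (1ℤ / 4 * (fromℕ 4 - R)) - fromℕ 2 * (0ℚ - c * (e * 0ℚ))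
      lemma = solve-∀ ring
    row (pendant i) = trans
      (D-pendant (λ b → L-entry b hub) i L-hub (sum-const r -½) (sum-const r 0ℚ)
          (neighbourSum-const (-½ + 0ℚ) i) refl)
      (lemma R c)
      where
      lemma : ∀ R c → fromℕ 2 * (½ * R) + fromℕ 3 * (R * -½) + fromℕ 4 * (R * 0ℚ) - fromℕ 4 *
          (-½ + 0ℚ) - fromℕ 2 * 0ℚ ≡
              fromℕ 2 * (1ℤ / 4 * (fromℕ 4 - R)) - fromℕ 2 * (0ℚ - c * (0ℚ * 0ℚ))
      lemma = solve-∀ ring
  DL hub (rim j) = trans (D-hub (λ b → L-entry b (rim j)) (sum-A j) (sum-B j)) (lemma c (εᶠ j))
    where
    lemma : ∀ c e → 1ℚ + ½ + fromℕ 2 * - 1ℚ ≡ fromℕ 2 * w₁ - fromℕ 2 * (0ℚ - c * (0ℚ * e))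
    lemma = solve-∀ ring
  DL (rim i) (rim j) = trans
    (D-rim (λ b → L-entry b (rim j)) i refl (sum-A j) (sum-B j) (neighbourSum-A+B j i))
    (lemma (identity i j) (c * (εᶠ i * εᶠ j)))
    where
    lemma : ∀ d e → -½ + fromℕ 2 * (1ℚ + ½) + fromℕ 3 * - 1ℚ - (fromℕ 2 * d - fromℕ 2 * e) ≡
            fromℕ 2 * w₁ - fromℕ 2 * (d - e)
    lemma = solve-∀ ring
  DL (pendant i) (rim j) = trans
    -- The -2I of the pendant block contributes -2B, which cancels -S(A + B) = 2B; hence this block
    -- of the projection vanishes.
    (D-pendant (λ b → L-entry b (rim j)) i refl (sum-A j) (sum-B j) (neighbourSum-A+B j i) (B≡ i j))
    (lemma (identity i j) (c * (εᶠ i * εᶠ j)) c (εᶠ j))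
    where
    lemma : ∀ d e c g → fromℕ 2 * -½ + fromℕ 3 * (1ℚ + ½) + fromℕ 4 * - 1ℚ -
        (fromℕ 2 * d - fromℕ 2 * e) - fromℕ 2 * (e - d) ≡
            fromℕ 2 * w₁ - fromℕ 2 * (0ℚ - c * (0ℚ * g))
    lemma = solve-∀ ring
  DL hub (pendant j) = trans (D-hub (λ b → L-entry b (pendant j)) (sum-B j) (sum-identity-column j)) (lemma c)
    where
    lemma : ∀ c → - 1ℚ + fromℕ 2 * 1ℚ ≡ fromℕ 2 * w₂ - fromℕ 2 * (0ℚ - c * (0ℚ * 0ℚ))
    lemma = solve-∀ ring
  DL (rim i) (pendant j) = trans
    (D-rim (λ b → L-entry b (pendant j)) i refl (sum-B j) (sum-identity-column j) (neighbourSum-B+I j i))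
    (lemma c (εᶠ i))
    where
    lemma : ∀ c e → 0ℚ + fromℕ 2 * - 1ℚ + fromℕ 3 * 1ℚ - 0ℚ ≡ fromℕ 2 * w₂ - fromℕ 2 * (0ℚ - c * (e * 0ℚ))
    lemma = solve-∀ ring
  DL (pendant i) (pendant j) = trans
    (D-pendant (λ b → L-entry b (pendant j)) i refl (sum-B j) (sum-identity-column j)
        (neighbourSum-B+I j i) refl)
    (lemma c (identity i j))
    where
    lemma : ∀ c d → fromℕ 2 * 0ℚ + fromℕ 3 * - 1ℚ + fromℕ 4 * 1ℚ - 0ℚ - fromℕ 2 * d ≡
            fromℕ 2 * w₂ - fromℕ 2 * (d - c * (0ℚ * 0ℚ))
    lemma = solve-∀ ring

  sum-zero : sum {r} (λ _ → 0ℚ) ≡ 0ℚ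
  sum-zero = sum-replicate-zero r

  neighbourSum-ε+0 : ∀ i → neighbourSum (λ k → εᶠ k + 0ℚ) i ≡ 0ℚ
  neighbourSum-ε+0 i = trans (neighbourSum-cong (λ k → ℚ.+-identityʳ (εᶠ k)) i) (neighbourSum-ε i)

  -- The alternating vector has total 0 and is killed by `S`, and the rows of `D` see nothing else
  -- of it.
  Dz : ∀ a → sumᵛ (λ b → Dᵛ a b * zᵛ b) ≡ 0ℚ
  Dz hub         = D-hub zᵛ sum-ε sum-zero
  Dz (rim i)     = D-rim zᵛ i refl sum-ε sum-zero (neighbourSum-ε+0 i)
  Dz (pendant i) = D-pendant zᵛ i refl sum-ε sum-zero (neighbourSum-ε+0 i) refl

  sumᵛ-z : ∀ (f : Vertex r → ℚ) → sumᵛ (λ b → zᵛ b * f b) ≡ sum (λ k → εᶠ k * f (rim k))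
  sumᵛ-z f = begin
    0ℚ * f hub + (sum (λ k → εᶠ k * f (rim k)) + sum (λ k → 0ℚ * f (pendant k)))
      ≡⟨ cong (λ s → 0ℚ * f hub + (sum (λ k → εᶠ k * f (rim k)) + s)) (*-distribˡ-sum 0ℚ (f ∘ pendant)) ⟨
    0ℚ * f hub + (sum (λ k → εᶠ k * f (rim k)) + 0ℚ * sum (f ∘ pendant))
      ≡⟨ lemma (f hub) (sum (λ k → εᶠ k * f (rim k))) (sum (f ∘ pendant)) ⟩
    sum (λ k → εᶠ k * f (rim k)) ∎
    where
    lemma : ∀ h s t → 0ℚ * h + (s + 0ℚ * t) ≡ s
    lemma = solve-∀ ring

  sum-ε-const : ∀ s → sum (λ k → εᶠ k * s) ≡ 0ℚ
  sum-ε-const s = trans (≡.sym (*-distribʳ-sum s εᶠ)) (trans (cong (_* s) sum-ε) (ℚ.*-zeroˡ s))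

  zL : ∀ v → sumᵛ (λ b → zᵛ b * L-entry b v) ≡ 0ℚ
  zL v@hub         = trans (sumᵛ-z (λ b → L-entry b v)) (sum-ε-const -½)
  zL v@(rim j)     = trans (sumᵛ-z (λ b → L-entry b v)) (sum-ε-A j)
  zL v@(pendant j) = trans (sumᵛ-z (λ b → L-entry b v)) (sum-ε-B j)

  zw : sumᵛ (λ b → zᵛ b * wᵛ b) ≡ 0ℚ
  zw = trans (sumᵛ-z wᵛ) (sum-ε-const w₁)

  -- Symmetry of D and L

  -- `next` and `prev` are mutually inverse, so the transpose of one shift is the other.
  identity-next : ∀ i j → identity (next i) j ≡ identity (prev j) i
  identity-next i j with next i ≟ j | prev j ≟ i
  ... | yes _  | yes _ = refl
  ... | no _   | no _  = refl
  ... | yes eq | no ¬e = contradiction (trans (cong prev (≡.sym eq)) (prev-next i)) ¬e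
  ... | no ¬e  | yes eq = contradiction (trans (cong next (≡.sym eq)) (next-prev j)) ¬e

  S-sym : ∀ i j → S i j ≡ S j i
  S-sym i j = begin
    fromℕ 2 * identity i j + identity (next i) j + identity (prev i) j
      ≡⟨ cong₂ _+_ (cong₂ (λ s t → fromℕ 2 * s + t) (identity-sym i j) (identity-next i j))
          (≡.sym (identity-next j i)) ⟩
    fromℕ 2 * identity j i + identity (prev j) i + identity (next j) i
      ≡⟨ lemma (fromℕ 2 * identity j i) (identity (prev j) i) (identity (next j) i) ⟩
    fromℕ 2 * identity j i + identity (next j) i + identity (prev j) i ∎
    where
    lemma : ∀ a b c → a + b + c ≡ a + c + b
    lemma = solve-∀ ring

  rimDist-sym : ∀ i j → fromℕ (rimDist i j) ≡ fromℕ (rimDist j i)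
  rimDist-sym i j = trans (fromℕ-rimDist i j)
      (trans (cong (λ s → fromℕ 2 - s) (S-sym i j)) (≡.sym (fromℕ-rimDist j i)))

  suc-rimDist-sym : ∀ i j → fromℕ (suc (rimDist i j)) ≡ fromℕ (suc (rimDist j i))
  suc-rimDist-sym i j = trans (fromℕ-suc (rimDist i j))
    (trans (cong (λ s → 1ℚ + s) (rimDist-sym i j)) (≡.sym (fromℕ-suc (rimDist j i))))

  Dᵛ-sym : ∀ a b → Dᵛ a b ≡ Dᵛ b a
  Dᵛ-sym hub         hub         = refl
  Dᵛ-sym hub         (rim _)     = refl
  Dᵛ-sym hub         (pendant _) = refl
  Dᵛ-sym (rim _)     hub         = refl
  Dᵛ-sym (rim i)     (rim j)     = rimDist-sym i j
  Dᵛ-sym (rim i)     (pendant j) = suc-rimDist-sym i j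
  Dᵛ-sym (pendant _) hub         = refl
  Dᵛ-sym (pendant i) (rim j)     = suc-rimDist-sym i j
  Dᵛ-sym (pendant i) (pendant j) = trans (fromℕ-pendantDist i j) (trans
    (cong₂ (λ s t → fromℕ 4 - s - fromℕ 2 * t) (S-sym i j) (identity-sym i j))
    (≡.sym (fromℕ-pendantDist j i)))

  L-entry-sym : ∀ a b → L-entry a b ≡ L-entry b a
  L-entry-sym hub         hub         = refl
  L-entry-sym hub         (rim _)     = refl
  L-entry-sym hub         (pendant _) = refl
  L-entry-sym (rim _)     hub         = refl
  L-entry-sym (rim i)     (rim j)     = A-sym i j
  L-entry-sym (rim i)     (pendant j) = B-sym i j
  L-entry-sym (pendant _) hub         = refl
  L-entry-sym (pendant i) (rim j)     = B-sym i j
  L-entry-sym (pendant i) (pendant j) = identity-sym i j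

  -- The projection and the Moore-Penrose inverse

  γ : ℚ
  γ = + 4 / (3 ℕ.* r)

  γ*3R≡4 : γ * (fromℕ 3 * R) ≡ fromℕ 4
  γ*3R≡4 = trans (cong (λ d → γ * d) (≡.sym (fromℕ-* 3 r))) (/-*-cancel (+ 4) (3 ℕ.* r))

  X P : Matrix (order r) (order r)
  X = -½ • L ⊕ γ • (column w ⊗ column w ᵀ)
  P u v = identity u v - c * (zᵛ (vertex u) * zᵛ (vertex v))

  -- An arbitrary `f` serves both the rows of `D` and the vector z.
  sum-X : ∀ (f : Vertex r → ℚ) v {s t} →
    sumᵛ (λ b → f b * L-entry b (vertex v)) ≡ s → sumᵛ (λ b → f b * wᵛ b) ≡ t →
    sum (λ k → f (vertex k) * X k v) ≡ -½ * s + γ * w v * t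
  sum-X f v refl refl = begin
    -- The `0ℚ` ends the sum over the single inner index of w w'.
    sum (λ k → f (vertex k) * (-½ * L k v + γ * (w k * w v + 0ℚ)))
      ≡⟨ sum-cong-≗ (λ k → lemma (f (vertex k)) (L k v) γ (w k) (w v)) ⟩
    sum (λ k → -½ * (f (vertex k) * L k v) + γ * w v * (f (vertex k) * w k))
      ≡⟨ sum-linear -½ (γ * w v) (λ k → f (vertex k) * L k v) (λ k → f (vertex k) * w k) ⟩
    -½ * sum (λ k → f (vertex k) * L k v) + γ * w v * sum (λ k → f (vertex k) * w k)
      ≡⟨ cong₂ (λ s t → -½ * s + γ * w v * t)
          (sum-vertex (λ b → f b * L-entry b (vertex v))) (sum-vertex (λ b → f b * wᵛ b)) ⟩
    -½ * sumᵛ (λ b → f b * L-entry b (vertex v)) + γ * w v * sumᵛ (λ b → f b * wᵛ b) ∎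
    where
    lemma : ∀ d l g x y → d * (-½ * l + g * (x * y + 0ℚ)) ≡ -½ * (d * l) + g * y * (d * x)
    lemma = solve-∀ ring

  DX≋P : D ⊗ X ≋ P
  DX≋P u v = begin
    sum (λ k → D u k * X k v)
      ≡⟨ sum-cong-≗ (λ k → cong (_* X k v) (D≡Dᵛ u k)) ⟩
    sum (λ k → Dᵛ (vertex u) (vertex k) * X k v)
      ≡⟨ sum-X (Dᵛ (vertex u)) v (DL (vertex u) (vertex v)) (Dw (vertex u)) ⟩
    -½ * (fromℕ 2 * w v - fromℕ 2 * Pᵛ (vertex u) (vertex v)) + γ * w v * (+ 3 / 4 * R)
      -- The rank-one contributions collect into `w v` times a factor that vanishes because γ · 3R =
      -- 4.
      ≡⟨ lemma (w v) (Pᵛ (vertex u) (vertex v)) γ R ⟩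
    Pᵛ (vertex u) (vertex v) + w v * (1ℤ / 4 * (γ * (fromℕ 3 * R)) - 1ℚ)
      ≡⟨ cong (λ s → Pᵛ (vertex u) (vertex v) + w v * (1ℤ / 4 * s - 1ℚ)) γ*3R≡4 ⟩
    Pᵛ (vertex u) (vertex v) + w v * 0ℚ
      ≡⟨ cong (λ s → Pᵛ (vertex u) (vertex v) + s) (ℚ.*-zeroʳ (w v)) ⟩
    Pᵛ (vertex u) (vertex v) + 0ℚ
      ≡⟨ ℚ.+-identityʳ _ ⟩
    Pᵛ (vertex u) (vertex v)
      ≡⟨ cong (_- c * (zᵛ (vertex u) * zᵛ (vertex v))) (identity-vertex r u v) ⟨
    P u v ∎
    where
    lemma : ∀ y p g R → -½ * (fromℕ 2 * y - fromℕ 2 * p) + g * y * (+ 3 / 4 * R) ≡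
                        p + y * (1ℤ / 4 * (g * (fromℕ 3 * R)) - 1ℚ)
    lemma = solve-∀ ring

  P-fixes : ∀ (N : Matrix (order r) (order r)) → (∀ v → sum (λ k → zᵛ (vertex k) * N k v) ≡ 0ℚ) → P ⊗ N ≋ N
  P-fixes N zN≡0 u v = begin
    sum (λ k → (identity u k - c * (z u * z k)) * N k v)
      ≡⟨ sum-cong-≗ (λ k → lemma (identity u k) c (z u) (z k) (N k v)) ⟩
    sum (λ k → 1ℚ * (identity u k * N k v) + - (c * z u) * (z k * N k v))
      ≡⟨ sum-linear 1ℚ (- (c * z u)) (λ k → identity u k * N k v) (λ k → z k * N k v) ⟩
    1ℚ * sum (λ k → identity u k * N k v) + - (c * z u) * sum (λ k → z k * N k v)
      ≡⟨ cong₂ (λ s t → 1ℚ * s + - (c * z u) * t) (sum-identity u (λ k → N k v)) (zN≡0 v) ⟩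
    1ℚ * N u v + - (c * z u) * 0ℚ
      ≡⟨ lemma₂ (N u v) (- (c * z u)) ⟩
    N u v ∎
    where
    z : Fin (order r) → ℚ
    z k = zᵛ (vertex k)
    lemma : ∀ d c y z x → (d - c * (y * z)) * x ≡ 1ℚ * (d * x) + - (c * y) * (z * x)
    lemma = solve-∀ ring
    lemma₂ : ∀ x a → 1ℚ * x + a * 0ℚ ≡ x
    lemma₂ = solve-∀ ring

  zD : ∀ v → sum (λ k → zᵛ (vertex k) * D k v) ≡ 0ℚ
  zD v = begin
    sum (λ k → zᵛ (vertex k) * D k v)
      ≡⟨ sum-cong-≗ (λ k → trans (ℚ.*-comm (zᵛ (vertex k)) (D k v))
          (cong (_* zᵛ (vertex k)) (trans (D≡Dᵛ k v) (Dᵛ-sym (vertex k) (vertex v))))) ⟩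
    sum (λ k → Dᵛ (vertex v) (vertex k) * zᵛ (vertex k))
      ≡⟨ sum-vertex (λ b → Dᵛ (vertex v) b * zᵛ b) ⟩
    sumᵛ (λ b → Dᵛ (vertex v) b * zᵛ b)
      ≡⟨ Dz (vertex v) ⟩
    0ℚ ∎

  zX : ∀ v → sum (λ k → zᵛ (vertex k) * X k v) ≡ 0ℚ
  zX v = trans (sum-X zᵛ v (zL (vertex v)) zw) (lemma (γ * w v))
    where
    lemma : ∀ a → -½ * 0ℚ + a * 0ℚ ≡ 0ℚ
    lemma = solve-∀ ring

  D-moorePenrose : IsMoorePenroseInverse D X
  D-moorePenrose = symmetric⇒moorePenrose
    (λ u v → trans (D≡Dᵛ v u) (trans (Dᵛ-sym (vertex v) (vertex u)) (≡.sym (D≡Dᵛ u v))))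
    (λ u v → cong₂ (λ s t → -½ * s + γ * (t + 0ℚ)) (L-entry-sym (vertex v) (vertex u)) (ℚ.*-comm (w v) (w u)))
    (λ u v → cong₂ (λ s t → s - c * t) (identity-sym v u) (ℚ.*-comm (zᵛ (vertex v)) (zᵛ (vertex u))))
    DX≋P
    (P-fixes D zD)
    (P-fixes X zX)

theorem4p13 : (n : ℕ) (5≤n : 5 ≤ n) → n % 2 ≡ 1 →
    let open Helm n 5≤n in
    IsMoorePenroseInverse D
    (-½ • L ⊕ (+ 4 / (3 ℕ.* (n ∸ 1))) • (column w ⊗ column w ᵀ))
theorem4p13 (suc zero)    (s≤s ()) odd
theorem4p13 (suc (suc p)) 5≤n      odd = HelmInverse.D-moorePenrose p 5≤n odd
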